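{- Let $k\ge 2$, let $\sigma=\underline{\sigma_1\sigma_2\cdots\sigma_{k-1}}$ be any consecutive pattern on $\{1,2,\ldots,k-1\}$, and let $p=\sigma k=\underline{\sigma_1\cdots\sigma_{k-1}}k$ be the corresponding quasi-consecutive pattern of length $k$ ending with its largest element. Then $$A^p(x,t)=\frac{1}{t}\left(e^{t\int_0^x A^{\sigma}(y,t)\,dy}-1\right)+1 .$$
   Context: Let $\mathfrak{S}_n$ be the set of permutations of $\{1,\ldots,n\}$ in one-line notation $\pi=\pi_1\cdots\pi_n$ ($\mathfrak{S}_0$ consists of the empty permutation only). $\mathrm{std}$ denotes standardization: replace the $i$-th smallest letter by $i$. The descent number is $\mathrm{des}(\pi)=|\{i\in[n-1]:\pi_i>\pi_{i+1}\}|$. A vincular pattern $\omega$ of length $k$ is a permutation in $\mathfrak{S}_k$ some of whose consecutive letters may be underlined. An occurrence of $\omega$ in $\pi$ is a subsequence $\pi_{i_1}\cdots\pi_{i_k}$ ($i_1<\cdots<i_k$) whose standardization is $\omega$, such that letters corresponding to a block of letters underlined together occupy adjacent positions in $\pi$. $\pi$ avoids $\omega$ if it has no occurrence of $\omega$; $\mathfrak{S}_n(\omega)$ is the set of $\omega$-avoiding permutations in $\mathfrak{S}_n$. A consecutive pattern is one in which all letters are underlined together (so its occurrences are at adjacent positions). In $p=\sigma k$ the first $k-1$ letters must be adjacent in an occurrence, while there is no adjacency condition on the last letter. $A_n^{\omega}(t)=\sum_{\pi\in\mathfrak{S}_n(\omega)}t^{\mathrm{des}(\pi)}$, with $A_0^{\omega}(t)=1$,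 and $A^{\omega}(x,t)=\sum_{n\ge 0}A_n^{\omega}(t)\frac{x^n}{n!}$. Identities are between formal power series in $x$ (integration in $y$ is termwise). -}

module Defs where

open import Algebra.Bundles.Raw using (RawRing)
import Algebra.Definitions.RawMonoid as RawMonoidDefs
import Algebra.Definitions.RawSemiring as RawSemiringDefs
open import Data.Bool.Base using (Bool; true; false; if_then_else_)
import Data.Bool.Properties as Bool
open import Data.Fin.Base as Fin using (Fin; toℕ)
import Data.Fin.Properties as Fin
open import Data.Integer.Base using (+_)
open import Data.List.Base as List using (List; []; _∷_)
open import Data.Nat.Base as ℕ using (ℕ; zero; suc; _∸_; _!)
import Data.Nat.Properties as ℕ
open import Data.Product.Base using (∃; _×_; _,_)
open import Data.Rational.Base as ℚ using (ℚ)
open import Data.Vec.Base as Vec using (Vec; []; _∷_; _∷ʳ_; lookup)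
import Data.Vec.Properties as Vec
open import Data.Vec.Relation.Unary.AllPairs using (allPairs?)
open import Data.Vec.Relation.Unary.Unique.Propositional using (Unique)
open import Function.Base using (_∘_)
open import Level using (0ℓ)
open import Relation.Binary.PropositionalEquality.Core using (_≡_)
open import Relation.Nullary.Decidable.Core
  using (Dec; does; map′; ¬?; _×-dec_; _→-dec_)
open import Relation.Nullary.Negation.Core using (¬_)
open import Relation.Unary using (Pred; Decidable)

------------------------------------------------------------------------
-- Permutations in one-line notation

words : {A : Set} → List A → ∀ n → List (Vec A n)
words as zero    = [] ∷ []
words as (suc n) = List.cartesianProductWith _∷_ as (words as n)

unique? : ∀ {n} → Decidable (Unique {A = ℕ} {n})
unique? = allPairs? (λ a b → ¬? (a ℕ.≟ b))

-- The letters are 1, …, n, and each permutation is listed exactly once.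
𝔖 : ∀ n → List (Vec ℕ n)
𝔖 n = List.filter unique? (words (List.applyUpTo suc n) n)

des : ∀ {n} → Vec ℕ n → ℕ
des []          = 0
des (a ∷ [])    = 0
des (a ∷ b ∷ w) = (if does (b ℕ.<? a) then 1 else 0) ℕ.+ des (b ∷ w)

-- In a word with distinct letters, the i-th smallest letter is the one
-- that has exactly i − 1 smaller letters.
std : ∀ {n} → Vec ℕ n → Vec ℕ n
std w = Vec.map (λ a → suc (Vec.count (ℕ._<? a) w)) w

------------------------------------------------------------------------
-- Vincular patterns

-- Entry j of `joined` says whether letter j is underlined together with
-- the letter before it; the entry of the first letter has no meaning.
record Vincular (k : ℕ) : Set where
  field
    letters : Vec ℕ k
    joined  : Vec Bool k

open Vincular public

consecutive : ∀ {k} → Vec ℕ k → Vincular k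
consecutive σ = record { letters = σ ; joined = Vec.replicate _ true }

-- Append a letter that is not underlined.
infixl 5 _▹_
_▹_ : ∀ {k} → Vincular k → ℕ → Vincular (suc k)
ω ▹ a = record { letters = letters ω ∷ʳ a ; joined = joined ω ∷ʳ false }

module _ {k n : ℕ} (ω : Vincular k) (π : Vec ℕ n) where

  Increasing : Vec (Fin n) k → Set
  Increasing is = ∀ j l → j Fin.< l → lookup is j Fin.< lookup is l

  Adjacent : Vec (Fin n) k → Set
  Adjacent is = ∀ j l → toℕ l ≡ suc (toℕ j) → lookup (joined ω) l ≡ true →
                toℕ (lookup is l) ≡ suc (toℕ (lookup is j))

  IsOccurrence : Vec (Fin n) k → Set
  IsOccurrence is = Increasing is × Adjacent is
                  × std (Vec.map (lookup π) is) ≡ letters ω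

  Avoids : Set
  Avoids = ¬ ∃ IsOccurrence

  isOccurrence? : Decidable IsOccurrence
  isOccurrence? is =
    Fin.all? (λ j → Fin.all? λ l →
      (j Fin.<? l) →-dec (lookup is j Fin.<? lookup is l))
    ×-dec
    Fin.all? (λ j → Fin.all? λ l →
      (toℕ l ℕ.≟ suc (toℕ j)) →-dec
      ((lookup (joined ω) l Bool.≟ true) →-dec
       (toℕ (lookup is l) ℕ.≟ suc (toℕ (lookup is j)))))
    ×-dec
    Vec.≡-dec ℕ._≟_ (std (Vec.map (lookup π) is)) (letters ω)

anyVec? : ∀ {n} k {P : Pred (Vec (Fin n) k) 0ℓ} → Decidable P → Dec (∃ P)
anyVec? zero    P? = map′ (λ p → [] , p) (λ { ([] , p) → p }) (P? [])
anyVec? (suc k) P? =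
  map′ (λ { (i , is , p) → i ∷ is , p }) (λ { (i ∷ is , p) → i , is , p })
       (Fin.any? λ i → anyVec? k (P? ∘ (i ∷_)))

avoids? : ∀ {k n} (ω : Vincular k) → Decidable (Avoids {k} {n} ω)
avoids? ω π = ¬? (anyVec? _ (isOccurrence? ω π))

𝔖-avoiding : ∀ {k} → Vincular k → ∀ n → List (Vec ℕ n)
𝔖-avoiding ω n = List.filter (avoids? ω) (𝔖 n)

------------------------------------------------------------------------
-- Constructions on rings

powerSeries : RawRing 0ℓ 0ℓ → RawRing 0ℓ 0ℓ
powerSeries R = record
  { Carrier = ℕ → Carrier
  ; _≈_     = λ f g → ∀ n → f n ≈ g n
  ; _+_     = λ f g n → f n + g n
  ; _*_     = λ f g n → sum {suc n} (λ i → f (toℕ i) * g (n ∸ toℕ i))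
  ; -_      = λ f n → - f n
  ; 0#      = λ _ → 0#
  ; 1#      = λ { zero → 1# ; (suc _) → 0# }
  }
  where
  open RawRing R
  open RawMonoidDefs +-rawMonoid using (sum)

-- Adjoins an inverse of s: the pair (m , f) stands for f / s^m.  The
-- equality is the correct one when s is not a zero divisor.
localise : (R : RawRing 0ℓ 0ℓ) → RawRing.Carrier R → RawRing 0ℓ 0ℓ
localise R s = record
  { Carrier = ℕ × Carrier
  ; _≈_     = λ { (m , f) (n , g) → s ^ n * f ≈ s ^ m * g }
  ; _+_     = λ { (m , f) (n , g) → m ℕ.+ n , s ^ n * f + s ^ m * g }
  ; _*_     = λ { (m , f) (n , g) → m ℕ.+ n , f * g }
  ; -_      = λ { (m , f) → m , - f }
  ; 0#      = 0 , 0#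
  ; 1#      = 0 , 1#
  }
  where
  open RawRing R
  open RawSemiringDefs rawSemiring using (_^_)

------------------------------------------------------------------------
-- The ring K = ℚ((t)) of formal Laurent series, which contains ℚ[t] and 1/t

ℚ⟦t⟧ : RawRing 0ℓ 0ℓ
ℚ⟦t⟧ = powerSeries ℚ.+-*-rawRing

indeterminate : RawRing.Carrier ℚ⟦t⟧
indeterminate 1 = ℚ.1ℚ
indeterminate _ = ℚ.0ℚ

K : RawRing 0ℓ 0ℓ
K = localise ℚ⟦t⟧ indeterminate

module K where
  open RawRing K public
  open RawMonoidDefs +-rawMonoid public using (sum)
  open RawSemiringDefs rawSemiring public using (_^_)

t t⁻¹ : K.Carrier
t   = 0 , indeterminate
t⁻¹ = 1 , RawRing.1# ℚ⟦t⟧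

rational : ℚ → K.Carrier
rational q = 0 , λ { zero → q ; (suc _) → ℚ.0ℚ }

------------------------------------------------------------------------
-- Formal power series in x over K

K⟦x⟧ : RawRing 0ℓ 0ℓ
K⟦x⟧ = powerSeries K

module K⟦x⟧ where
  open RawRing K⟦x⟧ public
  open RawSemiringDefs rawSemiring public using (_^_)

  infixl 6 _-_
  _-_ : Carrier → Carrier → Carrier
  f - g = f + (- g)

  const : K.Carrier → Carrier
  const a zero    = a
  const a (suc _) = K.0#

  1/_! : ℕ → K.Carrier
  1/ n ! = rational (ℚ._/_ (+ 1) (n !) {{n ℕ.!≢0}})

  ∫ : Carrier → Carrier
  ∫ f zero    = K.0#
  ∫ f (suc n) = rational (+ 1 ℚ./ suc n) K.* f n

  -- Meaningful when f has constant term 0: then f ^ m has no terms of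
  -- degree below m, so only m ≤ n contribute to the coefficient of xⁿ.
  exp : Carrier → Carrier
  exp f n = K.sum {suc n} (λ m → 1/ toℕ m ! K.* (f ^ toℕ m) n)

-- For k ≥ 1 the empty permutation avoids ω, so that A₀ = 1.
Aₙ : ∀ {k} → Vincular k → ℕ → K.Carrier
Aₙ ω n =
  List.foldr K._+_ K.0# (List.map (λ π → t K.^ des π) (𝔖-avoiding ω n))

A : ∀ {k} → Vincular k → K⟦x⟧.Carrier
A ω n = K⟦x⟧.1/ n ! K.* Aₙ ω n

{-# OPTIONS --safe #-}

-- Let M be the largest letter of a permutation w = L M R.  An occurrence of p in w lies
-- either inside R, or has its underlined block inside L, where M can always serve as the
-- final letter.  Hence w avoids p = σk exactly when L avoids σ and R avoids p, while
-- des w = des L + des R + 1, or des L if R is empty.  With G = 1 + t (Aᵖ − 1), and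
-- distributing the remaining letters over L and R, this reads (Aᵖ)′ = A^σ · G, that is
-- G′ = t A^σ · G with G(0) = 1, a differential equation that exp (t ∫ A^σ) solves too.

module Submission where

open import Defs
import Algebra.Consequences.Setoid as Consequences
import Algebra.Construct.Pointwise as Pointwise
import Algebra.Properties.CommutativeMonoid.Mult as Mult
import Algebra.Properties.CommutativeSemigroup as CommutativeSemigroupProperties
import Algebra.Properties.Ring as RingProperties
import Algebra.Properties.Semiring.Exp as Exp
import Algebra.Properties.Semiring.Mult as SemiringMult
import Algebra.Properties.Semiring.Sum as Sum
import Algebra.Solver.Ring.NaturalCoefficients.Default as Solver
open import Algebra.Bundles using (CommutativeRing)
open import Algebra.Bundles.Raw using (RawRing)
open import Data.Bool.Base using (true; false; if_then_else_)
open import Data.Fin.Base as Fin using (Fin; toℕ; fromℕ; fromℕ<; inject₁)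
import Data.Fin.Properties as Fin
open import Data.Fin.Relation.Unary.Top using (view; ‵fromℕ; ‵inject₁)
open import Data.Integer.Base as ℤ using (ℤ)
import Data.Integer.Properties as ℤ
open import Data.List.Base as List using (List; []; _∷_; _++_; length; upTo; applyUpTo)
open import Data.List.Membership.Propositional using (_∈_; _∉_; find; lose)
open import Data.List.Membership.Propositional.Properties
open import Data.List.Membership.Propositional.Properties.WithK using (unique∧set⇒bag)
import Data.List.Properties as List
open import Data.List.Relation.Binary.BagAndSetEquality using (∼bag⇒↭)
open import Data.List.Relation.Binary.Disjoint.Propositional using (Disjoint)
open import Data.List.Relation.Binary.Permutation.Propositional as ↭
  using (_↭_; ↭-refl; ↭-sym; ↭-trans; ↭-prep; ↭-reflexive)
import Data.List.Relation.Binary.Permutation.Propositional.Properties as ↭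
import Data.List.Relation.Binary.Permutation.Setoid.Properties as ↭Setoid
open import Data.List.Relation.Unary.All as All using (All; []; _∷_)
import Data.List.Relation.Unary.All.Properties as All
open import Data.List.Relation.Unary.AllPairs as AllPairs using (AllPairs; []; _∷_)
import Data.List.Relation.Unary.AllPairs.Properties as AllPairs
open import Data.List.Relation.Unary.Any using (Any; here; there)
import Data.List.Relation.Unary.Any.Properties as Any
open import Data.List.Relation.Unary.Unique.Propositional using (Unique)
import Data.List.Relation.Unary.Unique.Propositional.Properties as Unique
open import Data.Nat.Base as ℕ using (ℕ; zero; suc; _≤_; _<_; _∸_; _!; NonZero; z≤n; s≤s)
open import Data.Nat.Properties as ℕ using (_<?_)
open import Data.Product.Base using (∃; ∃₂; _,_; proj₁; proj₂; map₁; map₂)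
open import Data.Rational.Base as ℚ using (ℚ; _/_; fromℚᵘ; toℚᵘ; 0ℚ)
import Data.Rational.Properties as ℚ
open import Data.Rational.Unnormalised.Base as ℚᵘ using (mkℚᵘ; *≡*)
import Data.Rational.Unnormalised.Properties as ℚᵘ
open import Data.Sum.Base using (_⊎_; inj₁; inj₂; [_,_]′)
open import Data.Vec.Base as Vec using (Vec; []; _∷_; _∷ʳ_; lookup; toList; fromList; tabulate)
import Data.Vec.Properties as Vec
import Data.Vec.Relation.Unary.All as VecAll
import Data.Vec.Relation.Unary.All.Properties as VecAll
import Data.Vec.Relation.Unary.AllPairs as VecAllPairs
import Data.Vec.Relation.Unary.Unique.Propositional as VecUnique
import Data.Vec.Relation.Unary.Unique.Propositional.Properties as VecUnique
open import Function.Base using (_∘_; id)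
open import Function.Bundles using (_⇔_; mk⇔; Equivalence)
open import Level using (0ℓ)
open import Relation.Binary.Bundles using (Setoid)
open import Relation.Binary.Definitions using (tri<; tri≈; tri>)
open import Relation.Binary.PropositionalEquality.Core as ≡ using (_≡_)
import Relation.Binary.Reasoning.Setoid as SetoidReasoning
open import Relation.Binary.Structures using (IsEquivalence)
open import Relation.Nullary.Decidable using (yes; no; does; does-⇔; dec-true; dec-false)
open import Relation.Nullary.Negation using (¬_; contradiction)
open import Relation.Unary using (Decidable; Pred)

-- Formal power series and localisation

-- The underlined block cannot contain `M`, since the final letter would then have to exceed `M`;
-- and a block of adjacent letters that avoids `M` lies wholly on one side of it. This is why only
-- the two listed cases arise. The empty `R` is the only case in which `M` adds no descent. So `R`
-- is counted by 1 in size 0 and by `t` times the count for `p` in positive size. These are the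
-- coefficients of `G`, and they account for both ones and for the factor `1/t` in the identity. The
-- parts `L` and `R` are words over arbitrary sets of letters, whereas the generating functions
-- count permutations of 1, ..., n. Avoiders are therefore enumerated over any sorted alphabet, and
-- increasing relabellings carry the counts back to the standard one. On the analytic side the
-- differential equation is solved coefficientwise: `n + 1` times the coefficient of degree `n + 1`
-- is fixed by the lower ones. Hence positive integers must be invertible, besides `t`.

module PowerSeries (R : CommutativeRing 0ℓ 0ℓ) where

  open CommutativeRing R
  open SetoidReasoning setoid
  open Solver commutativeSemiring using (solve; _:+_; _:*_; _:=_; con)

  Series : Set
  Series = ℕ → Carrier

  infixl 7 _⊛_
  _⊛_ : Series → Series → Series
  _⊛_ = RawRing._*_ (powerSeries rawRing)

  infix 4 _≋_
  _≋_ : Series → Series → Set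
  f ≋ g = ∀ n → f n ≈ g n

  shift : Series → Series
  shift f n = f (suc n)

  ⊛-cong : ∀ {f f′ g g′} → f ≋ f′ → g ≋ g′ → f ⊛ g ≋ f′ ⊛ g′
  ⊛-cong         p q zero    = +-congʳ (*-cong (p 0) (q 0))
  ⊛-cong {g = g} p q (suc n) = +-cong (*-cong (p 0) (q (suc n))) (⊛-cong {g = g} (p ∘ suc) q n)

  -- The product computes by peeling the constant term off the left factor. This is the mirror
  -- image, which peels the right factor; commutativity follows by playing the two against each
  -- other.
  ⊛-sucʳ : ∀ f g n → (f ⊛ g) (suc n) ≈ (f ⊛ shift g) n + f (suc n) * g 0
  ⊛-sucʳ f g zero = solve 4 (λ a b c d →
    (a :* d) :+ ((b :* c) :+ con 0) := ((a :* d) :+ con 0) :+ (b :* c))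
    refl (f 0) (f 1) (g 0) (g 1)
  ⊛-sucʳ f g (suc n) = begin
    f 0 * g (suc (suc n)) + (shift f ⊛ g) (suc n)
      ≈⟨ +-congˡ (⊛-sucʳ (shift f) g n) ⟩
    f 0 * g (suc (suc n)) + ((shift f ⊛ shift g) n + f (suc (suc n)) * g 0)
      ≈⟨ +-assoc _ _ _ ⟨
    f 0 * g (suc (suc n)) + (shift f ⊛ shift g) n + f (suc (suc n)) * g 0 ∎

  ⊛-comm : ∀ f g → f ⊛ g ≋ g ⊛ f
  ⊛-comm f g zero    = +-congʳ (*-comm (f 0) (g 0))
  ⊛-comm f g (suc n) = begin
    f 0 * g (suc n) + (shift f ⊛ g) n ≈⟨ +-cong (*-comm _ _) (⊛-comm (shift f) g n) ⟩
    g (suc n) * f 0 + (g ⊛ shift f) n ≈⟨ +-comm _ _ ⟩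
    (g ⊛ shift f) n + g (suc n) * f 0 ≈⟨ ⊛-sucʳ g f n ⟨
    (g ⊛ f) (suc n)                   ∎

  ⊛-distribʳ : ∀ h f g → (λ n → f n + g n) ⊛ h ≋ (λ n → (f ⊛ h) n + (g ⊛ h) n)
  ⊛-distribʳ h f g zero = solve 3 (λ a b c →
    ((a :+ b) :* c) :+ con 0 := ((a :* c) :+ con 0) :+ ((b :* c) :+ con 0))
    refl (f 0) (g 0) (h 0)
  ⊛-distribʳ h f g (suc n) = begin
    (f 0 + g 0) * h (suc n) + ((λ m → f (suc m) + g (suc m)) ⊛ h) n
      ≈⟨ +-congˡ (⊛-distribʳ h (shift f) (shift g) n) ⟩
    (f 0 + g 0) * h (suc n) + ((shift f ⊛ h) n + (shift g ⊛ h) n)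
      ≈⟨ solve 5 (λ a b c x y →
           ((a :+ b) :* c) :+ (x :+ y) := ((a :* c) :+ x) :+ ((b :* c) :+ y))
           refl (f 0) (g 0) (h (suc n)) ((shift f ⊛ h) n) ((shift g ⊛ h) n) ⟩
    (f ⊛ h) (suc n) + (g ⊛ h) (suc n) ∎

  ⊛-distribˡ : ∀ h f g → h ⊛ (λ n → f n + g n) ≋ (λ n → (h ⊛ f) n + (h ⊛ g) n)
  ⊛-distribˡ h f g n = begin
    (h ⊛ (λ m → f m + g m)) n ≈⟨ ⊛-comm h (λ m → f m + g m) n ⟩
    ((λ m → f m + g m) ⊛ h) n ≈⟨ ⊛-distribʳ h f g n ⟩
    (f ⊛ h) n + (g ⊛ h) n     ≈⟨ +-cong (⊛-comm f h n) (⊛-comm g h n) ⟩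
    (h ⊛ f) n + (h ⊛ g) n     ∎

  ⊛-scaleˡ : ∀ a f g → (λ n → a * f n) ⊛ g ≋ (λ n → a * (f ⊛ g) n)
  ⊛-scaleˡ a f g zero = solve 3 (λ a b c →
    ((a :* b) :* c) :+ con 0 := a :* ((b :* c) :+ con 0)) refl a (f 0) (g 0)
  ⊛-scaleˡ a f g (suc n) = begin
    a * f 0 * g (suc n) + ((λ m → a * f (suc m)) ⊛ g) n
      ≈⟨ +-cong (*-assoc _ _ _) (⊛-scaleˡ a (shift f) g n) ⟩
    a * (f 0 * g (suc n)) + a * (shift f ⊛ g) n
      ≈⟨ distribˡ _ _ _ ⟨
    a * (f ⊛ g) (suc n) ∎

  ⊛-assoc : ∀ f g h → (f ⊛ g) ⊛ h ≋ f ⊛ (g ⊛ h)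
  ⊛-assoc f g h zero = solve 3 (λ a b c →
    (((a :* b) :+ con 0) :* c) :+ con 0 := (a :* ((b :* c) :+ con 0)) :+ con 0)
    refl (f 0) (g 0) (h 0)
  ⊛-assoc f g h (suc n) = begin
    (f 0 * g 0 + 0#) * h (suc n) + (shift (f ⊛ g) ⊛ h) n
      ≈⟨ +-congˡ (⊛-distribʳ h (λ m → f 0 * g (suc m)) (shift f ⊛ g) n) ⟩
    (f 0 * g 0 + 0#) * h (suc n) + (((λ m → f 0 * g (suc m)) ⊛ h) n + ((shift f ⊛ g) ⊛ h) n)
      ≈⟨ +-congˡ (+-cong (⊛-scaleˡ (f 0) (shift g) h n) (⊛-assoc (shift f) g h n)) ⟩
    (f 0 * g 0 + 0#) * h (suc n) + (f 0 * (shift g ⊛ h) n + (shift f ⊛ (g ⊛ h)) n)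
      ≈⟨ solve 5 (λ a b c x y →
           (((a :* b) :+ con 0) :* c) :+ ((a :* x) :+ y) := (a :* ((b :* c) :+ x)) :+ y)
           refl (f 0) (g 0) (h (suc n)) ((shift g ⊛ h) n) ((shift f ⊛ (g ⊛ h)) n) ⟩
    (f ⊛ (g ⊛ h)) (suc n) ∎

  ⊛-zeroˡ : ∀ {f} g → (∀ n → f n ≈ 0#) → ∀ n → (f ⊛ g) n ≈ 0#
  ⊛-zeroˡ g f≈0 zero    = trans (+-identityʳ _) (trans (*-congʳ (f≈0 0)) (zeroˡ _))
  ⊛-zeroˡ g f≈0 (suc n) = trans
    (+-cong (trans (*-congʳ (f≈0 0)) (zeroˡ _)) (⊛-zeroˡ g (f≈0 ∘ suc) n)) (+-identityˡ _)

  -- Being constant is expressed by coefficients, so that the same lemma covers the unit series, a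
  -- shift of the indeterminate, and the constants `t` and `1/t`.
  ⊛-constˡ : ∀ {a f} g → f 0 ≈ a → (∀ n → f (suc n) ≈ 0#) → ∀ n → (f ⊛ g) n ≈ a * g n
  ⊛-constˡ g p q zero    = trans (+-identityʳ _) (*-congʳ p)
  ⊛-constˡ g p q (suc n) = trans (+-cong (*-congʳ p) (⊛-zeroˡ g q n)) (+-identityʳ _)

  private
    one : Series
    one = RawRing.1# (powerSeries rawRing)

    identityˡ : ∀ f → one ⊛ f ≋ f
    identityˡ f n = trans (⊛-constˡ {f = one} f refl (λ _ → refl) n) (*-identityˡ (f n))

  commutativeRing : CommutativeRing 0ℓ 0ℓ
  commutativeRing = record
    { RawRing (powerSeries rawRing)
    ; isCommutativeRing = record
      { isRing = record
        { +-isAbelianGroup = Pointwise.isAbelianGroup ℕ +-isAbelianGroup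
        ; *-cong           = λ {f} {f′} {g} {g′} → ⊛-cong {f} {f′} {g} {g′}
        ; *-assoc          = ⊛-assoc
        ; *-identity       = identityˡ , λ f n → trans (⊛-comm f one n) (identityˡ f n)
        ; distrib          = ⊛-distribˡ , ⊛-distribʳ
        }
      ; *-comm = ⊛-comm
      }
    }

module Localisation (R : CommutativeRing 0ℓ 0ℓ) (s : CommutativeRing.Carrier R)
  (s-cancel : ∀ f g → CommutativeRing._≈_ R (CommutativeRing._*_ R s f) (CommutativeRing._*_ R s g) →
              CommutativeRing._≈_ R f g)
  where

  open CommutativeRing R
  open SetoidReasoning setoid
  open Solver commutativeSemiring using (solve; _:+_; _:*_; _:=_; con)
  open Exp semiring using (_^_; ^-homo-*)

  private module L = RawRing (localise rawRing s)

  numerators : ∀ {m n f g} → m ≡ n → f ≈ g → (m , f) L.≈ (n , g)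
  numerators ≡.refl = *-congˡ

  +-integral : ∀ f g → (0 , f) L.+ (0 , g) L.≈ (0 , f + g)
  +-integral f g = numerators {m = 0} ≡.refl (+-cong (*-identityˡ f) (*-identityˡ g))

  s⁻¹*s≈1 : (1 , 1#) L.* (0 , s) L.≈ L.1#
  s⁻¹*s≈1 = solve 1 (λ s → con 1 :* (con 1 :* s) := (s :* con 1) :* con 1) refl s

  private

    ^-cancel : ∀ n f g → s ^ n * f ≈ s ^ n * g → f ≈ g
    ^-cancel zero    f g p = trans (sym (*-identityˡ f)) (trans p (*-identityˡ g))
    ^-cancel (suc n) f g p = ^-cancel n f g (s-cancel _ _
      (trans (sym (*-assoc _ _ _)) (trans p (*-assoc _ _ _))))

    -- Here `s` must be a non-zero-divisor: combining the two cross-multiplied equations proves the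
    -- third one only up to the factor `s ^ n` from the middle denominator, which is then cancelled.
    L-trans : ∀ {x y z} → x L.≈ y → y L.≈ z → x L.≈ z
    L-trans {m , f} {n , g} {o , h} p q = ^-cancel n _ _ (begin
      s ^ n * (s ^ o * f) ≈⟨ swap (s ^ n) (s ^ o) f ⟩
      s ^ o * (s ^ n * f) ≈⟨ *-congˡ p ⟩
      s ^ o * (s ^ m * g) ≈⟨ swap (s ^ o) (s ^ m) g ⟩
      s ^ m * (s ^ o * g) ≈⟨ *-congˡ q ⟩
      s ^ m * (s ^ n * h) ≈⟨ swap (s ^ m) (s ^ n) h ⟩
      s ^ n * (s ^ m * h) ∎)
      where
      swap : ∀ a b c → a * (b * c) ≈ b * (a * c)
      swap = solve 3 (λ a b c → a :* (b :* c) := b :* (a :* c)) refl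

    +-cong′ : ∀ {x y u v} → x L.≈ y → u L.≈ v → x L.+ u L.≈ y L.+ v
    +-cong′ {m , f} {m′ , f′} {n , g} {n′ , g′} p q = begin
      s ^ (m′ ℕ.+ n′) * (s ^ n * f + s ^ m * g)
        ≈⟨ *-congʳ (^-homo-* s m′ n′) ⟩
      s ^ m′ * s ^ n′ * (s ^ n * f + s ^ m * g)
        ≈⟨ solve 6 (λ a′ b′ a b f g →
             (a′ :* b′) :* ((b :* f) :+ (a :* g)) :=
             ((b′ :* b) :* (a′ :* f)) :+ ((a′ :* a) :* (b′ :* g)))
             refl (s ^ m′) (s ^ n′) (s ^ m) (s ^ n) f g ⟩
      s ^ n′ * s ^ n * (s ^ m′ * f) + s ^ m′ * s ^ m * (s ^ n′ * g)
        ≈⟨ +-cong (*-congˡ p) (*-congˡ q) ⟩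
      s ^ n′ * s ^ n * (s ^ m * f′) + s ^ m′ * s ^ m * (s ^ n * g′)
        ≈⟨ solve 6 (λ a′ b′ a b f g →
             ((b′ :* b) :* (a :* f)) :+ ((a′ :* a) :* (b :* g)) :=
             (a :* b) :* ((b′ :* f) :+ (a′ :* g)))
             refl (s ^ m′) (s ^ n′) (s ^ m) (s ^ n) f′ g′ ⟩
      s ^ m * s ^ n * (s ^ n′ * f′ + s ^ m′ * g′)
        ≈⟨ *-congʳ (^-homo-* s m n) ⟨
      s ^ (m ℕ.+ n) * (s ^ n′ * f′ + s ^ m′ * g′) ∎

    *-cong′ : ∀ {x y u v} → x L.≈ y → u L.≈ v → x L.* u L.≈ y L.* v
    *-cong′ {m , f} {m′ , f′} {n , g} {n′ , g′} p q = begin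
      s ^ (m′ ℕ.+ n′) * (f * g)     ≈⟨ *-congʳ (^-homo-* s m′ n′) ⟩
      s ^ m′ * s ^ n′ * (f * g)     ≈⟨ interchange _ _ _ _ ⟩
      (s ^ m′ * f) * (s ^ n′ * g)   ≈⟨ *-cong p q ⟩
      (s ^ m * f′) * (s ^ n * g′)   ≈⟨ interchange _ _ _ _ ⟩
      s ^ m * s ^ n * (f′ * g′)     ≈⟨ *-congʳ (^-homo-* s m n) ⟨
      s ^ (m ℕ.+ n) * (f′ * g′)     ∎
      where open CommutativeSemigroupProperties *-commutativeSemigroup using (interchange)

    -‿cong′ : ∀ {x y} → x L.≈ y → L.- x L.≈ L.- y
    -‿cong′ p = trans (sym (-‿distribʳ-* _ _)) (trans (-‿cong p) (-‿distribʳ-* _ _))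
      where open RingProperties ring using (-‿distribʳ-*)

    +-assoc′ : ∀ x y z → (x L.+ y) L.+ z L.≈ x L.+ (y L.+ z)
    +-assoc′ (m , f) (n , g) (o , h) = numerators (ℕ.+-assoc m n o) (begin
      s ^ o * (s ^ n * f + s ^ m * g) + s ^ (m ℕ.+ n) * h
        ≈⟨ +-congˡ (*-congʳ (^-homo-* s m n)) ⟩
      s ^ o * (s ^ n * f + s ^ m * g) + s ^ m * s ^ n * h
        ≈⟨ solve 6 (λ a b c f g h →
             (c :* ((b :* f) :+ (a :* g))) :+ ((a :* b) :* h) :=
             ((b :* c) :* f) :+ (a :* ((c :* g) :+ (b :* h))))
             refl (s ^ m) (s ^ n) (s ^ o) f g h ⟩
      s ^ n * s ^ o * f + s ^ m * (s ^ o * g + s ^ n * h)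
        ≈⟨ +-congʳ (*-congʳ (^-homo-* s n o)) ⟨
      s ^ (n ℕ.+ o) * f + s ^ m * (s ^ o * g + s ^ n * h) ∎)

    +-comm′ : ∀ x y → x L.+ y L.≈ y L.+ x
    +-comm′ (m , f) (n , g) = numerators (ℕ.+-comm m n) (+-comm _ _)

    +-identityˡ′ : ∀ x → L.0# L.+ x L.≈ x
    +-identityˡ′ (m , f) = numerators {m = m} ≡.refl
      (trans (+-cong (zeroʳ _) (*-identityˡ f)) (+-identityˡ f))

    -‿inverseˡ′ : ∀ x → (L.- x) L.+ x L.≈ L.0#
    -‿inverseˡ′ (m , f) = begin
      1# * (s ^ m * - f + s ^ m * f) ≈⟨ *-identityˡ _ ⟩
      s ^ m * - f + s ^ m * f        ≈⟨ distribˡ _ _ _ ⟨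
      s ^ m * (- f + f)              ≈⟨ *-congˡ (-‿inverseˡ f) ⟩
      s ^ m * 0#                     ≈⟨ zeroʳ _ ⟩
      0#                             ≈⟨ zeroʳ _ ⟨
      s ^ (m ℕ.+ m) * 0#             ∎

    *-assoc′ : ∀ x y z → (x L.* y) L.* z L.≈ x L.* (y L.* z)
    *-assoc′ (m , f) (n , g) (o , h) = numerators (ℕ.+-assoc m n o) (*-assoc f g h)

    *-comm′ : ∀ x y → x L.* y L.≈ y L.* x
    *-comm′ (m , f) (n , g) = numerators (ℕ.+-comm m n) (*-comm f g)

    *-identityˡ′ : ∀ x → L.1# L.* x L.≈ x
    *-identityˡ′ (m , f) = numerators {m = m} ≡.refl (*-identityˡ f)

    distribˡ′ : ∀ x y z → x L.* (y L.+ z) L.≈ (x L.* y) L.+ (x L.* z)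
    distribˡ′ (m , f) (n , g) (o , h) = begin
      s ^ ((m ℕ.+ n) ℕ.+ (m ℕ.+ o)) * (f * (s ^ o * g + s ^ n * h))
        ≈⟨ *-congʳ (trans (^-homo-* s (m ℕ.+ n) (m ℕ.+ o)) (*-cong (^-homo-* s m n) (^-homo-* s m o))) ⟩
      (s ^ m * s ^ n) * (s ^ m * s ^ o) * (f * (s ^ o * g + s ^ n * h))
        ≈⟨ solve 6 (λ a b c f g h →
             ((a :* b) :* (a :* c)) :* (f :* ((c :* g) :+ (b :* h))) :=
             (a :* (b :* c)) :* (((a :* c) :* (f :* g)) :+ ((a :* b) :* (f :* h))))
             refl (s ^ m) (s ^ n) (s ^ o) f g h ⟩
      s ^ m * (s ^ n * s ^ o) * ((s ^ m * s ^ o) * (f * g) + (s ^ m * s ^ n) * (f * h))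
        ≈⟨ *-cong (trans (^-homo-* s m (n ℕ.+ o)) (*-congˡ (^-homo-* s n o)))
                  (+-cong (*-congʳ (^-homo-* s m o)) (*-congʳ (^-homo-* s m n))) ⟨
      s ^ (m ℕ.+ (n ℕ.+ o)) * (s ^ (m ℕ.+ o) * (f * g) + s ^ (m ℕ.+ n) * (f * h)) ∎

    L-isEquivalence : IsEquivalence L._≈_
    L-isEquivalence = record
      { refl  = refl
      ; sym   = sym
      ; trans = λ {x} {y} {z} → L-trans {x} {y} {z}
      }

    L-setoid : Setoid 0ℓ 0ℓ
    L-setoid = record { isEquivalence = L-isEquivalence }

  commutativeRing : CommutativeRing 0ℓ 0ℓ
  commutativeRing = record
    { RawRing (localise rawRing s)
    ; isCommutativeRing = record
      { isRing = record
        { +-isAbelianGroup = record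
          { isGroup = record
            { isMonoid = record
              { isSemigroup = record
                { isMagma = record
                  { isEquivalence = L-isEquivalence
                  ; ∙-cong        = λ {x} {y} {u} {v} → +-cong′ {x} {y} {u} {v}
                  }
                ; assoc = +-assoc′
                }
              ; identity = comm∧idˡ⇒id {L._+_} +-comm′ {L.0#} +-identityˡ′
              }
            ; inverse = comm∧invˡ⇒inv {L._+_} {L.-_} {L.0#} +-comm′ -‿inverseˡ′
            ; ⁻¹-cong = λ {x} {y} → -‿cong′ {x} {y}
            }
          ; comm = +-comm′
          }
        ; *-cong     = λ {x} {y} {u} {v} → *-cong′ {x} {y} {u} {v}
        ; *-assoc    = *-assoc′
        ; *-identity = comm∧idˡ⇒id {L._*_} *-comm′ {L.1#} *-identityˡ′
        ; distrib    = distribˡ′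
                     , comm∧distrˡ⇒distrʳ {L._*_} {L._+_}
                         (λ {x} {y} {u} {v} → +-cong′ {x} {y} {u} {v}) *-comm′ distribˡ′
        }
      ; *-comm = *-comm′
      }
    }
    where
    open Consequences L-setoid
      using (comm∧idˡ⇒id; comm∧invˡ⇒inv; comm∧distrˡ⇒distrʳ)

-- The exponential formula

module Derivation (R : CommutativeRing 0ℓ 0ℓ) where

  open CommutativeRing R
  open SetoidReasoning setoid
  open Solver commutativeSemiring using (solve; _:+_; _:*_; _:=_; con)
  open Mult +-commutativeMonoid using (_×_; ×-congʳ; ×-distrib-+)
  open SemiringMult semiring using (×-assoc-*; ×-comm-*)
  open Sum semiring using (sum)
  open PowerSeries R
    using (Series; _⊛_; _≋_; shift; ⊛-cong; ⊛-comm; ⊛-sucʳ; ⊛-distribʳ; ⊛-constˡ; ⊛-scaleˡ; ⊛-assoc)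
  private module PS = CommutativeRing (PowerSeries.commutativeRing R)
  open Exp PS.semiring using (_^_)

  ×-zeroʳ : ∀ n → n × 0# ≈ 0#
  ×-zeroʳ zero    = refl
  ×-zeroʳ (suc n) = trans (+-identityˡ _) (×-zeroʳ n)

  D : Series → Series
  D f n = suc n × f (suc n)

  private
    -- The Euler operator x d/dx. It preserves degrees, so its product rule can follow the recursion
    -- of `⊛`, which that of `D` cannot do directly.
    θ : Series → Series
    θ f n = n × f n

    -- Induction on the degree, using that the shift of `θ f` is `shift f` plus `θ (shift f)`.
    θ-leibniz : ∀ f g n → θ (f ⊛ g) n ≈ (θ f ⊛ g) n + (f ⊛ θ g) n
    θ-leibniz f g zero = sym (solve 2 (λ a b →
      ((con 0 :* b) :+ con 0) :+ ((a :* con 0) :+ con 0) := con 0) refl (f 0) (g 0))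
    θ-leibniz f g (suc n) = begin
      suc n × (f 0 * g (suc n) + (shift f ⊛ g) n)
        ≈⟨ ×-distrib-+ _ _ (suc n) ⟩
      suc n × (f 0 * g (suc n)) + ((shift f ⊛ g) n + n × (shift f ⊛ g) n)
        ≈⟨ +-cong (×-comm-* (suc n) _ _) (+-congˡ (sym (θ-leibniz (shift f) g n))) ⟨
      f 0 * θ g (suc n) + ((shift f ⊛ g) n + ((θ (shift f) ⊛ g) n + (shift f ⊛ θ g) n))
        ≈⟨ solve 6 (λ a b x y z w →
             (a :* b) :+ (x :+ (y :+ z)) := ((con 0 :* w) :+ (x :+ y)) :+ ((a :* b) :+ z))
             refl (f 0) (θ g (suc n)) ((shift f ⊛ g) n) ((θ (shift f) ⊛ g) n)
             ((shift f ⊛ θ g) n) (g (suc n)) ⟩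
      (0# * g (suc n) + ((shift f ⊛ g) n + (θ (shift f) ⊛ g) n)) + (f ⊛ θ g) (suc n)
        ≈⟨ +-congʳ (+-congˡ (⊛-distribʳ g (shift f) (θ (shift f)) n)) ⟨
      (θ f ⊛ g) (suc n) + (f ⊛ θ g) (suc n) ∎

  -- `D f` is the shift of `θ f`, so this is the rule for `θ` one degree higher. The two boundary
  -- terms vanish because `θ` kills constant terms.
  D-leibniz : ∀ f g n → D (f ⊛ g) n ≈ (D f ⊛ g) n + (f ⊛ D g) n
  D-leibniz f g n = begin
    θ (f ⊛ g) (suc n)
      ≈⟨ θ-leibniz f g (suc n) ⟩
    (0# * g (suc n) + (D f ⊛ g) n) + (f ⊛ θ g) (suc n)
      ≈⟨ +-congˡ (⊛-sucʳ f (θ g) n) ⟩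
    (0# * g (suc n) + (D f ⊛ g) n) + ((f ⊛ D g) n + f (suc n) * 0#)
      ≈⟨ solve 4 (λ a b x y → ((con 0 :* a) :+ x) :+ (y :+ (b :* con 0)) := x :+ y)
           refl (g (suc n)) (f (suc n)) ((D f ⊛ g) n) ((f ⊛ D g) n) ⟩
    (D f ⊛ g) n + (f ⊛ D g) n ∎

  ⊛-×ʳ : ∀ m f g n → (f ⊛ (λ i → m × g i)) n ≈ m × (f ⊛ g) n
  ⊛-×ʳ m f g zero    = trans (+-identityʳ _) (trans (×-comm-* m _ _) (×-congʳ m (sym (+-identityʳ _))))
  ⊛-×ʳ m f g (suc n) = trans (+-cong (×-comm-* m _ _) (⊛-×ʳ m (shift f) g n)) (sym (×-distrib-+ _ _ m))

  D-^ : ∀ f m n → D (f ^ suc m) n ≈ suc m × (f ^ m ⊛ D f) n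
  D-^ f zero n = begin
    suc n × (f ^ 1) (suc n) ≈⟨ ×-congʳ (suc n) (PS.*-identityʳ f (suc n)) ⟩
    D f n                   ≈⟨ PS.*-identityˡ (D f) n ⟨
    (f ^ 0 ⊛ D f) n         ≈⟨ +-identityʳ _ ⟨
    1 × (f ^ 0 ⊛ D f) n     ∎
  D-^ f (suc m) n = begin
    D (f ⊛ f ^ suc m) n
      ≈⟨ D-leibniz f (f ^ suc m) n ⟩
    (D f ⊛ f ^ suc m) n + (f ⊛ D (f ^ suc m)) n
      ≈⟨ +-cong (⊛-comm (D f) (f ^ suc m) n)
           (⊛-cong {f} {f} {D (f ^ suc m)} (λ _ → refl) (D-^ f m) n) ⟩
    (f ^ suc m ⊛ D f) n + (f ⊛ (λ i → suc m × (f ^ m ⊛ D f) i)) n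
      ≈⟨ +-congˡ (⊛-×ʳ (suc m) f (f ^ m ⊛ D f) n) ⟩
    (f ^ suc m ⊛ D f) n + suc m × (f ⊛ (f ^ m ⊛ D f)) n
      ≈⟨ +-congˡ (×-congʳ (suc m) (⊛-assoc f (f ^ m) (D f) n)) ⟨
    suc (suc m) × (f ^ suc m ⊛ D f) n ∎

  -- Coefficient `n` of a product sees only coefficients up to `n` of its factors. Both the
  -- truncation of the exponential and the uniqueness of solutions rest on this.
  ⊛-cong-≤ : ∀ {f f′} g n → (∀ i → i ≤ n → f i ≈ f′ i) → (f ⊛ g) n ≈ (f′ ⊛ g) n
  ⊛-cong-≤ g zero    p = +-congʳ (*-congʳ (p 0 z≤n))
  ⊛-cong-≤ g (suc n) p =
    +-cong (*-congʳ (p 0 z≤n)) (⊛-cong-≤ g n (λ i i≤n → p (suc i) (s≤s i≤n)))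

  ⊛-vanish : ∀ f {g} n → (∀ i → i ≤ n → g i ≈ 0#) → (f ⊛ g) n ≈ 0#
  ⊛-vanish f zero p = trans (+-identityʳ _) (trans (*-congˡ (p 0 z≤n)) (zeroʳ _))
  ⊛-vanish f {g} (suc n) p = trans
    (+-cong (trans (*-congˡ (p (suc n) ℕ.≤-refl)) (zeroʳ _))
            (⊛-vanish (shift f) {g} n (λ i i≤n → p i (ℕ.m≤n⇒m≤1+n i≤n))))
    (+-identityˡ _)

  -- A series without constant term is divisible by x, so its `m`-th power is divisible by the
  -- `m`-th power of x. This makes the finite sums in the exponential legitimate.
  ^-vanish : ∀ {f} → f 0 ≈ 0# → ∀ m n → n < m → (f ^ m) n ≈ 0#
  ^-vanish     f₀ (suc m) zero    _         = trans (+-identityʳ _) (trans (*-congʳ f₀) (zeroˡ _))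
  ^-vanish {f} f₀ (suc m) (suc n) (s≤s n<m) = trans
    (+-cong (trans (*-congʳ f₀) (zeroˡ _))
            (⊛-vanish (shift f) {f ^ m} n (λ i i≤n → ^-vanish {f} f₀ m i (ℕ.≤-<-trans i≤n n<m))))
    (+-identityˡ _)

  ∑ : ℕ → (ℕ → Carrier) → Carrier
  ∑ n F = sum {n} (F ∘ toℕ)

  ∑-cong : ∀ n {F G} → (∀ i → F i ≈ G i) → ∑ n F ≈ ∑ n G
  ∑-cong zero    p = refl
  ∑-cong (suc n) p = +-cong (p 0) (∑-cong n (p ∘ suc))

  ∑-zero : ∀ n {F} → (∀ i → F i ≈ 0#) → ∑ n F ≈ 0#
  ∑-zero zero    p = refl
  ∑-zero (suc n) p = trans (+-cong (p 0) (∑-zero n (p ∘ suc))) (+-identityˡ _)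

  ∑-truncate : ∀ {m n F} → m ≤ n → (∀ i → m ≤ i → F i ≈ 0#) → ∑ n F ≈ ∑ m F
  ∑-truncate {n = n} z≤n p = ∑-zero n (λ i → p i z≤n)
  ∑-truncate (s≤s m≤n)   p = +-congˡ (∑-truncate m≤n (λ i m≤i → p (suc i) (s≤s m≤i)))

  ×-distrib-∑ : ∀ m n F → m × ∑ n F ≈ ∑ n (λ i → m × F i)
  ×-distrib-∑ m zero    F = ×-zeroʳ m
  ×-distrib-∑ m (suc n) F = trans (×-distrib-+ _ _ m) (+-congˡ (×-distrib-∑ m n (F ∘ suc)))

  -- The bound `N` is the same in all degrees, unlike in the exponential, where it grows with the
  -- degree; `∑-truncate` reconciles the two.
  ∑-⊛ : ∀ N (c : ℕ → Carrier) (f : ℕ → Series) g n →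
        ((λ i → ∑ N (λ m → c m * f m i)) ⊛ g) n ≈ ∑ N (λ m → c m * (f m ⊛ g) n)
  ∑-⊛ zero    c f g n = PowerSeries.⊛-zeroˡ R {λ _ → 0#} g (λ _ → refl) n
  ∑-⊛ (suc N) c f g n = begin
    ((λ i → c 0 * f 0 i + ∑ N (λ m → c (suc m) * f (suc m) i)) ⊛ g) n
      ≈⟨ ⊛-distribʳ g (λ i → c 0 * f 0 i) (λ i → ∑ N (λ m → c (suc m) * f (suc m) i)) n ⟩
    ((λ i → c 0 * f 0 i) ⊛ g) n + ((λ i → ∑ N (λ m → c (suc m) * f (suc m) i)) ⊛ g) n
      ≈⟨ +-cong (⊛-scaleˡ (c 0) (f 0) g n) (∑-⊛ N (c ∘ suc) (f ∘ suc) g n) ⟩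
    ∑ (suc N) (λ m → c m * (f m ⊛ g) n) ∎

  -- ∑ᵢ C(n,i) aᵢ bₙ₋ᵢ, expanded by the side on which the first of the n points falls.
  binomialConvolution : (a b : ℕ → Carrier) → ℕ → Carrier
  binomialConvolution a b zero    = a 0 * b 0
  binomialConvolution a b (suc n) =
    binomialConvolution (shift a) b n + binomialConvolution a (shift b) n

  -- Division enters only through these two sequences and their defining equations, so the analysis
  -- never meets a concrete fraction.
  module ExponentialSeries
    (1/suc : ℕ → Carrier) (×-1/suc : ∀ n → suc n × 1/suc n ≈ 1#)
    (1/! : ℕ → Carrier) (1/0! : 1/! 0 ≈ 1#) (×-1/! : ∀ n → suc n × 1/! (suc n) ≈ 1/! n)
    where

    ×-cancel : ∀ n {x y} → suc n × x ≈ suc n × y → x ≈ y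
    ×-cancel n {x} {y} p = trans (sym (recover x)) (trans (*-congˡ p) (recover y))
      where
      recover : ∀ z → 1/suc n * (suc n × z) ≈ z
      recover z = begin
        1/suc n * (suc n × z)   ≈⟨ ×-comm-* (suc n) _ _ ⟩
        suc n × (1/suc n * z)   ≈⟨ ×-assoc-* (suc n) _ _ ⟨
        (suc n × 1/suc n) * z   ≈⟨ *-congʳ (×-1/suc n) ⟩
        1# * z                  ≈⟨ *-identityˡ z ⟩
        z                       ∎

    exponential : Series → Series
    exponential f n = ∑ (suc n) (λ m → 1/! m * (f ^ m) n)

    exponential-0 : ∀ f → exponential f 0 ≈ 1#
    exponential-0 f = trans (+-identityʳ _) (trans (*-identityʳ _) 1/0!)

    D-exponential : ∀ {f} → f 0 ≈ 0# → ∀ n → D (exponential f) n ≈ (exponential f ⊛ D f) n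
    D-exponential {f} f₀ n = begin
      suc n × ∑ (suc (suc n)) (λ m → 1/! m * (f ^ m) (suc n))
        ≈⟨ ×-distrib-∑ (suc n) (suc (suc n)) (λ m → 1/! m * (f ^ m) (suc n)) ⟩
      suc n × (1/! 0 * 0#) + ∑ (suc n) (λ m → suc n × (1/! (suc m) * (f ^ suc m) (suc n)))
        -- The term of `f ^ 0` has no coefficient in positive degree. In the others the factor
        -- `suc m` from the power rule turns the inverse of `(m + 1)!` into that of `m!`.
        ≈⟨ +-cong (trans (×-congʳ (suc n) (zeroʳ _)) (×-zeroʳ (suc n))) (∑-cong (suc n) term) ⟩
      0# + ∑ (suc n) (λ m → 1/! m * (f ^ m ⊛ D f) n)
        ≈⟨ +-identityˡ _ ⟩
      ∑ (suc n) (λ m → 1/! m * (f ^ m ⊛ D f) n)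
        ≈⟨ ∑-⊛ (suc n) 1/! (f ^_) (D f) n ⟨
      ((λ i → ∑ (suc n) (λ m → 1/! m * (f ^ m) i)) ⊛ D f) n
        -- One side sums up to the common bound `suc n`, the other up to `suc i` for each `i ≤ n`.
        -- The surplus terms have `i < m`, where `f ^ m` vanishes.
        ≈⟨ ⊛-cong-≤ {f = λ i → ∑ (suc n) (λ m → 1/! m * (f ^ m) i)} (D f) n (λ i i≤n →
             ∑-truncate {F = λ m → 1/! m * (f ^ m) i} (s≤s i≤n) (λ m i<m →
             trans (*-congˡ (^-vanish {f} f₀ m i i<m)) (zeroʳ _))) ⟩
      (exponential f ⊛ D f) n ∎
      where
      term : ∀ m → suc n × (1/! (suc m) * (f ^ suc m) (suc n)) ≈ 1/! m * (f ^ m ⊛ D f) n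
      term m = begin
        suc n × (1/! (suc m) * (f ^ suc m) (suc n)) ≈⟨ ×-comm-* (suc n) _ _ ⟨
        1/! (suc m) * D (f ^ suc m) n               ≈⟨ *-congˡ (D-^ f m n) ⟩
        1/! (suc m) * (suc m × (f ^ m ⊛ D f) n)     ≈⟨ ×-comm-* (suc m) _ _ ⟩
        suc m × (1/! (suc m) * (f ^ m ⊛ D f) n)     ≈⟨ ×-assoc-* (suc m) _ _ ⟨
        (suc m × 1/! (suc m)) * (f ^ m ⊛ D f) n     ≈⟨ *-congʳ (×-1/! m) ⟩
        1/! m * (f ^ m ⊛ D f) n                     ∎

    D-unique : ∀ h {f g} → f 0 ≈ g 0 → D f ≋ f ⊛ h → D g ≋ g ⊛ h → f ≋ g
    D-unique h {f} {g} f₀≈g₀ Df Dg n = agree n n ℕ.≤-refl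
      where
      -- Strong induction in bounded form: coefficient `suc i` of a solution is determined by all
      -- coefficients up to `i`.
      agree : ∀ n i → i ≤ n → f i ≈ g i
      agree n       zero    _         = f₀≈g₀
      agree (suc n) (suc i) (s≤s i≤n) = ×-cancel i (begin
        D f i     ≈⟨ Df i ⟩
        (f ⊛ h) i ≈⟨ ⊛-cong-≤ {f} {g} h i (λ j j≤i → agree n j (ℕ.≤-trans j≤i i≤n)) ⟩
        (g ⊛ h) i ≈⟨ Dg i ⟨
        D g i     ∎)

    egf : (ℕ → Carrier) → Series
    egf a n = 1/! n * a n

    D-egf : ∀ a → D (egf a) ≋ egf (shift a)
    D-egf a n = trans (sym (×-assoc-* (suc n) _ _)) (*-congʳ (×-1/! n))

    -- On egfs, shifting a sequence is differentiation, so the recursion of `binomialConvolution` is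
    -- the Leibniz rule. Both sides thus have the same derivative, and `suc n` can be cancelled.
    egf-binomialConvolution : ∀ a b → egf (binomialConvolution a b) ≋ egf a ⊛ egf b
    egf-binomialConvolution a b zero = begin
      1/! 0 * (a 0 * b 0)                 ≈⟨ *-congʳ 1/0! ⟩
      1# * (a 0 * b 0)                    ≈⟨ *-identityˡ _ ⟩
      a 0 * b 0                           ≈⟨ *-cong (scale (a 0)) (scale (b 0)) ⟨
      (1/! 0 * a 0) * (1/! 0 * b 0)       ≈⟨ +-identityʳ _ ⟨
      (1/! 0 * a 0) * (1/! 0 * b 0) + 0#  ∎
      where
      scale : ∀ x → 1/! 0 * x ≈ x
      scale x = trans (*-congʳ 1/0!) (*-identityˡ x)
    egf-binomialConvolution a b (suc n) = ×-cancel n (begin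
      D (egf (binomialConvolution a b)) n
        ≈⟨ D-egf (binomialConvolution a b) n ⟩
      1/! n * (binomialConvolution (shift a) b n + binomialConvolution a (shift b) n)
        ≈⟨ distribˡ _ _ _ ⟩
      egf (binomialConvolution (shift a) b) n + egf (binomialConvolution a (shift b)) n
        ≈⟨ +-cong (egf-binomialConvolution (shift a) b n) (egf-binomialConvolution a (shift b) n) ⟩
      (egf (shift a) ⊛ egf b) n + (egf a ⊛ egf (shift b)) n
        ≈⟨ +-cong (⊛-cong {g = egf b} (D-egf a) (λ _ → refl) n)
                  (⊛-cong {f = egf a} {g = D (egf b)} (λ _ → refl) (D-egf b) n) ⟨
      (D (egf a) ⊛ egf b) n + (egf a ⊛ D (egf b)) n
        ≈⟨ D-leibniz (egf a) (egf b) n ⟨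
      D (egf a ⊛ egf b) n ∎)

    -- Every series in the identity is a variable with its defining equation: `T`, `T⁻¹` and `one`
    -- are constant series, `φ` is the exponent, `E` its exponential, and `H` the whole right-hand
    -- side. The sequence `b` has egf `G` of the overview.
    exponentialFormula :
      ∀ {τ τ⁻¹} → τ⁻¹ * τ ≈ 1# →
      ∀ {T T⁻¹ : Series} → T 0 ≈ τ → (∀ n → T (suc n) ≈ 0#) → T⁻¹ 0 ≈ τ⁻¹ → (∀ n → T⁻¹ (suc n) ≈ 0#) →
      ∀ {a b p : Series} → b 0 ≈ 1# → (∀ n → b (suc n) ≈ τ * p (suc n)) →
      p 0 ≈ 1# → (∀ n → p (suc n) ≈ binomialConvolution a b n) →
      ∀ {A P : Series} → A ≋ egf a → P ≋ egf p →
      ∀ {I : Series} → I 0 ≈ 0# → (∀ n → I (suc n) ≈ 1/suc n * A n) →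
      ∀ {φ E one F G H : Series} → φ ≋ T ⊛ I → E ≋ exponential φ →
      one 0 ≈ 1# → (∀ n → one (suc n) ≈ 0#) →
      (∀ n → F n ≈ E n - one n) → G ≋ T⁻¹ ⊛ F → (∀ n → H n ≈ G n + one n) →
      P ≋ H
    exponentialFormula {τ} {τ⁻¹} inv {T} {T⁻¹} T₀ Tₛ T⁻¹₀ T⁻¹ₛ {a} {b} {p} b₀ bₛ p₀ pₛ {A} {P} A≋ P≋
      {I} I₀ Iₛ {φ} {E} {one} {F} {G} {H} φ≋ E≋ one₀ oneₛ F≈ G≋ H≈ = λ n → trans (P≋ n) (formula n)
      where
      open RingProperties ring using (-0#≈0#)

      -- The common logarithmic derivative of `E` and of `egf b`.
      τA : Series
      τA n = τ * egf a n

      φ≈ : ∀ n → φ n ≈ τ * I n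
      φ≈ n = trans (φ≋ n) (⊛-constˡ {f = T} I T₀ Tₛ n)

      φ₀ : φ 0 ≈ 0#
      φ₀ = trans (φ≈ 0) (trans (*-congˡ I₀) (zeroʳ _))

      D-φ : D φ ≋ τA
      D-φ n = begin
        suc n × φ (suc n)
          ≈⟨ ×-congʳ (suc n) (trans (φ≈ (suc n)) (*-congˡ (trans (Iₛ n) (*-congˡ (A≋ n))))) ⟩
        suc n × (τ * (1/suc n * egf a n))  ≈⟨ ×-comm-* (suc n) _ _ ⟨
        τ * (suc n × (1/suc n * egf a n))  ≈⟨ *-congˡ (×-assoc-* (suc n) _ _) ⟨
        τ * ((suc n × 1/suc n) * egf a n)  ≈⟨ *-congˡ (*-congʳ (×-1/suc n)) ⟩
        τ * (1# * egf a n)                 ≈⟨ *-congˡ (*-identityˡ _) ⟩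
        τ * egf a n                        ∎

      E₀ : E 0 ≈ 1#
      E₀ = trans (E≋ 0) (exponential-0 φ)

      D-E : D E ≋ E ⊛ τA
      D-E n = begin
        D E n                        ≈⟨ ×-congʳ (suc n) (E≋ (suc n)) ⟩
        D (exponential φ) n          ≈⟨ D-exponential {φ} φ₀ n ⟩
        (exponential φ ⊛ D φ) n      ≈⟨ ⊛-cong {g = D φ} (λ i → sym (E≋ i)) D-φ n ⟩
        (E ⊛ τA) n                   ∎

      D-b : D (egf b) ≋ egf b ⊛ τA
      D-b n = begin
        D (egf b) n                                   ≈⟨ D-egf b n ⟩
        1/! n * b (suc n)                             ≈⟨ *-congˡ (trans (bₛ n) (*-congˡ (pₛ n))) ⟩
        1/! n * (τ * binomialConvolution a b n)
          ≈⟨ solve 3 (λ e s x → e :* (s :* x) := s :* (e :* x)) refl (1/! n) τ (binomialConvolution a b n) ⟩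
        τ * egf (binomialConvolution a b) n           ≈⟨ *-congˡ (egf-binomialConvolution a b n) ⟩
        τ * (egf a ⊛ egf b) n                         ≈⟨ ⊛-scaleˡ τ (egf a) (egf b) n ⟨
        (τA ⊛ egf b) n                                ≈⟨ ⊛-comm τA (egf b) n ⟩
        (egf b ⊛ τA) n                                ∎

      E≋egf-b : E ≋ egf b
      E≋egf-b = D-unique τA {E} {egf b}
        (trans E₀ (sym (trans (*-cong 1/0! b₀) (*-identityˡ 1#)))) D-E D-b

      rhs : ∀ n → H n ≈ τ⁻¹ * (E n - one n) + one n
      rhs n = trans (H≈ n) (+-congʳ
        (trans (G≋ n) (trans (⊛-constˡ {f = T⁻¹} F T⁻¹₀ T⁻¹ₛ n) (*-congˡ (F≈ n)))))

      formula : egf p ≋ H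
      -- Degree 0 stands apart because `b 0` is 1 and not `τ * p 0`; here `E - one` vanishes and the
      -- added one supplies the coefficient.
      formula zero = sym (begin
        H 0                            ≈⟨ rhs 0 ⟩
        τ⁻¹ * (E 0 - one 0) + one 0    ≈⟨ +-cong (*-congˡ (+-cong E₀ (-‿cong one₀))) one₀ ⟩
        τ⁻¹ * (1# - 1#) + 1#           ≈⟨ +-congʳ (trans (*-congˡ (-‿inverseʳ 1#)) (zeroʳ _)) ⟩
        0# + 1#                        ≈⟨ +-identityˡ _ ⟩
        1#                             ≈⟨ *-identityˡ 1# ⟨
        1# * 1#                        ≈⟨ *-cong 1/0! p₀ ⟨
        egf p 0                        ∎)
      -- In positive degree both ones disappear, and `τ⁻¹` removes the factor by which `b` differs
      -- from `p`.
      formula (suc n) = sym (begin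
        H (suc n)                                 ≈⟨ rhs (suc n) ⟩
        τ⁻¹ * (E (suc n) - one (suc n)) + one (suc n)
          ≈⟨ +-cong (*-congˡ (+-congˡ (trans (-‿cong (oneₛ n)) -0#≈0#))) (oneₛ n) ⟩
        τ⁻¹ * (E (suc n) + 0#) + 0#               ≈⟨ +-identityʳ _ ⟩
        τ⁻¹ * (E (suc n) + 0#)                    ≈⟨ *-congˡ (+-identityʳ _) ⟩
        τ⁻¹ * E (suc n)                           ≈⟨ *-congˡ (E≋egf-b (suc n)) ⟩
        τ⁻¹ * (1/! (suc n) * b (suc n))           ≈⟨ *-congˡ (*-congˡ (bₛ n)) ⟩
        τ⁻¹ * (1/! (suc n) * (τ * p (suc n)))
          ≈⟨ solve 4 (λ s s′ e q → s′ :* (e :* (s :* q)) := (s′ :* s) :* (e :* q))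
               refl τ τ⁻¹ (1/! (suc n)) (p (suc n)) ⟩
        τ⁻¹ * τ * egf p (suc n)                   ≈⟨ *-congʳ inv ⟩
        1# * egf p (suc n)                        ≈⟨ *-identityˡ _ ⟩
        egf p (suc n)                             ∎)

open import Relation.Binary.PropositionalEquality

-- Laurent series in t

module LaurentSeries where

  open import Data.Integer.Base using (+_)

  module ℚ⟦t⟧ where
    open PowerSeries ℚ.+-*-commutativeRing public

    indeterminate-shifts : ∀ f n → (indeterminate ⊛ f) (suc n) ≡ f n
    indeterminate-shifts f n = begin
      0ℚ ℚ.* f (suc n) ℚ.+ (shift indeterminate ⊛ f) n
        ≡⟨ cong₂ ℚ._+_ (ℚ.*-zeroˡ (f (suc n))) (⊛-constˡ {f = shift indeterminate} f refl (λ _ → refl) n) ⟩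
      0ℚ ℚ.+ ℚ.1ℚ ℚ.* f n
        ≡⟨ ℚ.+-identityˡ _ ⟩
      ℚ.1ℚ ℚ.* f n
        ≡⟨ ℚ.*-identityˡ (f n) ⟩
      f n ∎
      where open ≡-Reasoning

    -- Multiplication by `t` only shifts coefficients, so it is injective. This is what the
    -- localisation at `t` asks for.
    indeterminate-cancel : ∀ f g → indeterminate ⊛ f ≋ indeterminate ⊛ g → f ≋ g
    indeterminate-cancel f g p n =
      trans (sym (indeterminate-shifts f n)) (trans (p (suc n)) (indeterminate-shifts g n))

  open Localisation ℚ⟦t⟧.commutativeRing indeterminate ℚ⟦t⟧.indeterminate-cancel
    using (numerators; +-integral; s⁻¹*s≈1) renaming (commutativeRing to K-commutativeRing) public

  module KR = CommutativeRing K-commutativeRing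
  open Mult KR.+-commutativeMonoid using (_×_)

  -- Sums in `ℚ` are normalised. The identity is therefore checked on unnormalised fractions, where
  -- it is a cross-multiplication of integers.
  1/-+ : ∀ m d → (+ 1 / suc d) ℚ.+ (+ m / suc d) ≡ + suc m / suc d
  1/-+ m d = ℚ.toℚᵘ-injective (begin
    toℚᵘ ((+ 1 / suc d) ℚ.+ (+ m / suc d))
      ≈⟨ ℚ.toℚᵘ-homo-+ (+ 1 / suc d) (+ m / suc d) ⟩
    toℚᵘ (fromℚᵘ (mkℚᵘ (+ 1) d)) ℚᵘ.+ toℚᵘ (fromℚᵘ (mkℚᵘ (+ m) d))
      ≈⟨ ℚᵘ.+-cong (ℚ.toℚᵘ-fromℚᵘ (mkℚᵘ (+ 1) d)) (ℚ.toℚᵘ-fromℚᵘ (mkℚᵘ (+ m) d)) ⟩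
    mkℚᵘ (+ 1) d ℚᵘ.+ mkℚᵘ (+ m) d
      ≈⟨ *≡* (trans (cong (ℤ._* D) (sym (ℤ.*-distribʳ-+ D (+ 1) (+ m)))) (ℤ.*-assoc (+ suc m) D D)) ⟩
    mkℚᵘ (+ suc m) d
      ≈⟨ ℚ.toℚᵘ-fromℚᵘ (mkℚᵘ (+ suc m) d) ⟨
    toℚᵘ (+ suc m / suc d) ∎)
    where
    open import Relation.Binary.Reasoning.Setoid ℚᵘ.≃-setoid
    D : ℤ
    D = + suc d

  /-cross : ∀ a d b e → a ℕ.* suc e ≡ b ℕ.* suc d → + a / suc d ≡ + b / suc e
  /-cross a d b e p = ℚ.fromℚᵘ-cong {mkℚᵘ (+ a) d} {mkℚᵘ (+ b) e}
    (*≡* (trans (sym (ℤ.pos-* a (suc e))) (trans (cong +_ p) (ℤ.pos-* b (suc d)))))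

  integral-cong : ∀ {f g : ℕ → ℚ} → (∀ n → f n ≡ g n) → (0 , f) K.≈ (0 , g)
  integral-cong {f} {g} = numerators {0} {0} {f} {g} refl

  rational-+ : ∀ p q → rational p K.+ rational q K.≈ rational (p ℚ.+ q)
  rational-+ p q = KR.trans
    {rational p K.+ rational q} {0 , f} {rational (p ℚ.+ q)}
    (+-integral (proj₂ (rational p)) (proj₂ (rational q)))
    (integral-cong {f} {proj₂ (rational (p ℚ.+ q))} λ where
      zero    → refl
      (suc _) → refl)
    where
    f : ℕ → ℚ
    f n = proj₂ (rational p) n ℚ.+ proj₂ (rational q) n

  -- Derivatives are written with repeated addition in `K`; this evaluates such a sum as a single
  -- fraction.
  ×-1/ : ∀ m d → m × rational (+ 1 / suc d) K.≈ rational (+ m / suc d)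
  ×-1/ zero    d = integral-cong {λ _ → 0ℚ} {proj₂ (rational (+ 0 / suc d))} λ where
    zero    → /-cross 0 0 0 d refl
    (suc _) → refl
  ×-1/ (suc m) d = KR.trans
    {suc m × rational (+ 1 / suc d)} {rational (+ 1 / suc d) K.+ rational (+ m / suc d)}
    {rational (+ suc m / suc d)}
    (KR.+-congˡ {rational (+ 1 / suc d)} {m × rational (+ 1 / suc d)} {rational (+ m / suc d)}
      (×-1/ m d))
    (subst (λ q → rational (+ 1 / suc d) K.+ rational (+ m / suc d) K.≈ rational q) (1/-+ m d)
      (rational-+ (+ 1 / suc d) (+ m / suc d)))

  -- The denominator is kept as a product because `suc n !` unfolds to one, which makes `×-1/!` an
  -- instance.
  ×-1/* : ∀ n d .{{_ : NonZero d}} .{{_ : NonZero (suc n ℕ.* d)}} →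
          suc n × rational (+ 1 / (suc n ℕ.* d)) K.≈ rational (+ 1 / d)
  ×-1/* n (suc d) = subst (λ q → suc n × rational (+ 1 / (suc n ℕ.* suc d)) K.≈ rational q)
    (/-cross (suc n) (d ℕ.+ n ℕ.* suc d) 1 d (sym (ℕ.*-identityˡ _)))
    (×-1/ (suc n) (d ℕ.+ n ℕ.* suc d))

  rational-1 : rational (+ 1 / 1) K.≈ K.1#
  rational-1 = integral-cong {proj₂ (rational (+ 1 / 1))} {RawRing.1# ℚ⟦t⟧} λ where
    zero    → refl
    (suc _) → refl

  1/suc : ℕ → K.Carrier
  1/suc n = rational (+ 1 / suc n)

  ×-1/suc : ∀ n → suc n × 1/suc n K.≈ K.1#
  ×-1/suc n = KR.trans {suc n × 1/suc n} {rational (+ 1 / 1)} {K.1#}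
    (subst (λ q → suc n × 1/suc n K.≈ rational q) (/-cross (suc n) n 1 0 (ℕ.*-comm (suc n) 1))
      (×-1/ (suc n) n))
    rational-1

  ×-1/! : ∀ n → suc n × K⟦x⟧.1/ suc n ! K.≈ K⟦x⟧.1/ n !
  ×-1/! n = ×-1/* n (n !) {{n ℕ.!≢0}} {{suc n ℕ.!≢0}}

  module KE = Derivation.ExponentialSeries K-commutativeRing 1/suc ×-1/suc K⟦x⟧.1/_! rational-1 ×-1/!

  open Derivation K-commutativeRing using (∑; ∑-cong)
  open Exp (CommutativeRing.semiring (PowerSeries.commutativeRing K-commutativeRing)) using (_^_)

  -- The two notions of sum agree by computation. Stating it for a variable `F` keeps that
  -- comparison away from the actual terms of the exponential.
  ∑-raw : ∀ n (F : ℕ → K.Carrier) → ∑ n F ≡ K.sum {n} (λ i → F (toℕ i))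
  ∑-raw n F = refl

  exp≋exponential : ∀ f n → K⟦x⟧.exp f n K.≈ KE.exponential f n
  exp≋exponential f n = subst (K._≈ KE.exponential f n)
    (∑-raw (suc n) (λ m → K⟦x⟧.1/ m ! K.* (f K⟦x⟧.^ m) n))
    (∑-cong (suc n) {λ m → K⟦x⟧.1/ m ! K.* (f K⟦x⟧.^ m) n} {λ m → K⟦x⟧.1/ m ! KR.* (f ^ m) n}
      (λ m → KR.refl {K⟦x⟧.1/ m ! K.* (f K⟦x⟧.^ m) n}))

  -- From here on every intermediate series is a variable with an equation, because conversion
  -- checking between composite series over K is prohibitively slow.

  *-≋ : ∀ f g {h} → h ≡ f K⟦x⟧.* g →
        PowerSeries._≋_ K-commutativeRing h (PowerSeries._⊛_ K-commutativeRing f g)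
  *-≋ f g refl n = KR.refl {(f K⟦x⟧.* g) n}

  sub-≋ : ∀ f g {h} → h ≡ f K⟦x⟧.- g → ∀ n → h n KR.≈ f n KR.- g n
  sub-≋ f g refl n = KR.refl {(f K⟦x⟧.- g) n}

  +-≋ : ∀ f g {h} → h ≡ f K⟦x⟧.+ g → ∀ n → h n KR.≈ f n KR.+ g n
  +-≋ f g refl n = KR.refl {(f K⟦x⟧.+ g) n}

  exp-≋ : ∀ f {h} → h ≡ K⟦x⟧.exp f → PowerSeries._≋_ K-commutativeRing h (KE.exponential f)
  exp-≋ f refl n = exp≋exponential f n

  exponentialFormula-K :
    ∀ (a b p : ℕ → K.Carrier) →
    b 0 K.≈ K.1# → (∀ n → b (suc n) K.≈ t K.* p (suc n)) →
    p 0 K.≈ K.1# → (∀ n → p (suc n) K.≈ Derivation.binomialConvolution K-commutativeRing a b n) →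
    ∀ A P I φ E F G H → (∀ n → A n ≡ K⟦x⟧.1/ n ! K.* a n) → (∀ n → P n ≡ K⟦x⟧.1/ n ! K.* p n) →
    I ≡ K⟦x⟧.∫ A → φ ≡ K⟦x⟧.const t K⟦x⟧.* I → E ≡ K⟦x⟧.exp φ → F ≡ E K⟦x⟧.- K⟦x⟧.1# →
    G ≡ K⟦x⟧.const t⁻¹ K⟦x⟧.* F → H ≡ G K⟦x⟧.+ K⟦x⟧.1# →
    P K⟦x⟧.≈ H
  exponentialFormula-K a b p b₀ bₛ p₀ pₛ A P I φ E F G H A≡ P≡ refl φ≡ E≡ F≡ G≡ H≡ =
    KE.exponentialFormula {t} {t⁻¹} s⁻¹*s≈1
      {K⟦x⟧.const t} {K⟦x⟧.const t⁻¹}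
      (KR.refl {t}) (λ _ → KR.refl {K.0#}) (KR.refl {t⁻¹}) (λ _ → KR.refl {K.0#})
      {a} {b} {p} b₀ bₛ p₀ pₛ {A} {P} (≡⇒≈ A≡) (≡⇒≈ P≡)
      {I} (KR.refl {K.0#}) (λ n → KR.refl {1/suc n K.* A n}) {φ} {E} {K⟦x⟧.1#} {F} {G} {H}
      (*-≋ (K⟦x⟧.const t) I φ≡) (exp-≋ φ E≡) (KR.refl {K.1#}) (λ _ → KR.refl {K.0#})
      (sub-≋ E K⟦x⟧.1# F≡) (*-≋ (K⟦x⟧.const t⁻¹) F G≡) (+-≋ G K⟦x⟧.1# H≡)
    where
    ≡⇒≈ : ∀ {X Y : ℕ → K.Carrier} → (∀ n → X n ≡ Y n) → PowerSeries._≋_ K-commutativeRing X Y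
    ≡⇒≈ {X} X≡Y n = subst (X n KR.≈_) (X≡Y n) (KR.refl {X n})

open LaurentSeries

open import Data.Product.Base using (_×_)

module Patterns where

  open import Data.Nat.Base using (_+_)

  -- Occurrences

  module _ {A : Set} where

    lookup-∷ʳ-inject₁ : ∀ {m} (xs : Vec A m) a j → lookup (xs ∷ʳ a) (inject₁ j) ≡ lookup xs j
    lookup-∷ʳ-inject₁ (x ∷ xs) a Fin.zero    = refl
    lookup-∷ʳ-inject₁ (x ∷ xs) a (Fin.suc j) = lookup-∷ʳ-inject₁ xs a j

    lookup-∷ʳ-fromℕ : ∀ {m} (xs : Vec A m) a → lookup (xs ∷ʳ a) (fromℕ m) ≡ a
    lookup-∷ʳ-fromℕ []       a = refl
    lookup-∷ʳ-fromℕ (x ∷ xs) a = lookup-∷ʳ-fromℕ xs a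

    drop-lookup : ∀ {n} (xs : Vec A n) i →
                  List.drop (toℕ i) (toList xs) ≡ lookup xs i ∷ List.drop (suc (toℕ i)) (toList xs)
    drop-lookup (x ∷ xs) Fin.zero    = refl
    drop-lookup (x ∷ xs) (Fin.suc i) = drop-lookup xs i

    lookup∈drop : ∀ {n} (xs : Vec A n) {m} i → m ≤ toℕ i → lookup xs i ∈ List.drop m (toList xs)
    lookup∈drop (x ∷ xs) Fin.zero    z≤n       = here refl
    lookup∈drop (x ∷ xs) (Fin.suc i) z≤n       = there (lookup∈drop xs i z≤n)
    lookup∈drop (x ∷ xs) (Fin.suc i) (s≤s m≤i) = lookup∈drop xs i m≤i

    ∈drop⇒lookup : ∀ {n} (xs : Vec A n) m {a} → a ∈ List.drop m (toList xs) →
                   ∃ λ i → m ≤ toℕ i × lookup xs i ≡ a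
    ∈drop⇒lookup (x ∷ xs) zero (here refl) = Fin.zero , z≤n , refl
    ∈drop⇒lookup (x ∷ xs) zero (there a∈)  =
      let i , _ , eq = ∈drop⇒lookup xs zero a∈ in Fin.suc i , z≤n , eq
    ∈drop⇒lookup (x ∷ xs) (suc m) a∈       =
      let i , m≤i , eq = ∈drop⇒lookup xs m a∈ in Fin.suc i , s≤s m≤i , eq
    ∈drop⇒lookup [] zero ()
    ∈drop⇒lookup [] (suc m) ()

  Adjacents : ∀ {n m} → Vec (Fin n) m → Set
  Adjacents is = ∀ j l → toℕ l ≡ suc (toℕ j) → toℕ (lookup is l) ≡ suc (toℕ (lookup is j))

  -- Translates positions into factors of a word: consecutive positions read off a contiguous block,
  -- and the remainder is known as well, which matters for the final letter of `p`.
  drop-adjacents : ∀ {n m} {A : Set} (xs : Vec A n) i (is : Vec (Fin n) m) → Adjacents (i ∷ is) →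
                   List.drop (toℕ i) (toList xs) ≡
                   toList (Vec.map (lookup xs) (i ∷ is)) ++ List.drop (suc m + toℕ i) (toList xs)
  drop-adjacents             xs i []        adj = drop-lookup xs i
  drop-adjacents {m = suc m} xs i (i′ ∷ is) adj = begin
    List.drop (toℕ i) (toList xs)
      ≡⟨ drop-lookup xs i ⟩
    lookup xs i ∷ List.drop (suc (toℕ i)) (toList xs)
      ≡⟨ cong (λ d → lookup xs i ∷ List.drop d (toList xs)) (adj Fin.zero (Fin.suc Fin.zero) refl) ⟨
    lookup xs i ∷ List.drop (toℕ i′) (toList xs)
      ≡⟨ cong (lookup xs i ∷_) (drop-adjacents xs i′ is (λ j l eq → adj (Fin.suc j) (Fin.suc l) (cong suc eq))) ⟩
    toList (Vec.map (lookup xs) (i ∷ i′ ∷ is)) ++ List.drop (suc m + toℕ i′) (toList xs)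
      ≡⟨ cong (λ d → toList (Vec.map (lookup xs) (i ∷ i′ ∷ is)) ++ List.drop d (toList xs))
           (trans (cong (suc m +_) (adj Fin.zero (Fin.suc Fin.zero) refl)) (ℕ.+-suc (suc m) (toℕ i))) ⟩
    toList (Vec.map (lookup xs) (i ∷ i′ ∷ is)) ++ List.drop (suc (suc m) + toℕ i) (toList xs) ∎
    where open ≡-Reasoning

  adjacents-toℕ : ∀ {n m} i (is : Vec (Fin n) m) → Adjacents (i ∷ is) → ∀ j →
                  toℕ (lookup (i ∷ is) j) ≡ toℕ j + toℕ i
  adjacents-toℕ i is        adj Fin.zero    = refl
  adjacents-toℕ i (i′ ∷ is) adj (Fin.suc j) = begin
    toℕ (lookup (i′ ∷ is) j) ≡⟨ adjacents-toℕ i′ is (λ j l eq → adj (Fin.suc j) (Fin.suc l) (cong suc eq)) j ⟩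
    toℕ j + toℕ i′           ≡⟨ cong (toℕ j +_) (adj Fin.zero (Fin.suc Fin.zero) refl) ⟩
    toℕ j + suc (toℕ i)      ≡⟨ ℕ.+-suc (toℕ j) (toℕ i) ⟩
    suc (toℕ j + toℕ i)      ∎
    where open ≡-Reasoning

  interval : ∀ {n} m i → m + i ≤ n → Vec (Fin n) m
  interval m i m+i≤n = tabulate (λ j → fromℕ< (ℕ.<-≤-trans (ℕ.+-monoˡ-< i (Fin.toℕ<n j)) m+i≤n))

  toℕ-interval : ∀ {n} m i (m+i≤n : m + i ≤ n) j → toℕ (lookup (interval m i m+i≤n) j) ≡ toℕ j + i
  toℕ-interval m i m+i≤n j = trans (cong toℕ (Vec.lookup∘tabulate _ j)) (Fin.toℕ-fromℕ< _)

  adjacents-interval : ∀ {n} m i (m+i≤n : m + i ≤ n) → Adjacents (interval m i m+i≤n)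
  adjacents-interval m i m+i≤n j l eq = begin
    toℕ (lookup (interval m i m+i≤n) l)       ≡⟨ toℕ-interval m i m+i≤n l ⟩
    toℕ l + i                                 ≡⟨ cong (_+ i) eq ⟩
    suc (toℕ j + i)                           ≡⟨ cong suc (toℕ-interval m i m+i≤n j) ⟨
    suc (toℕ (lookup (interval m i m+i≤n) j)) ∎
    where open ≡-Reasoning

  -- An occurrence of the consecutive pattern as a factorisation of the word. Without positions,
  -- cutting at `M` becomes a question about concatenation.
  record Window {m} (σ : Vec ℕ m) (w : List ℕ) : Set where
    constructor window
    field
      {before after} : List ℕ
      {block}        : Vec ℕ m
      split          : w ≡ before ++ toList block ++ after
      matches        : std block ≡ σ

  -- An occurrence of `p`. Its last letter is the largest and not underlined, so any later letter
  -- that exceeds the whole block will do.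
  record DominatedWindow {m} (σ : Vec ℕ m) (w : List ℕ) : Set where
    constructor dominatedWindow
    field
      {before after} : List ℕ
      {block}        : Vec ℕ m
      split          : w ≡ before ++ toList block ++ after
      matches        : std block ≡ σ
      dominated      : Any (λ x → All (_< x) (toList block)) after

  toList-injective : ∀ {A : Set} {n} {xs ys : Vec A n} → toList xs ≡ toList ys → xs ≡ ys
  toList-injective {xs = []}     {[]}     _  = refl
  toList-injective {xs = x ∷ xs} {y ∷ ys} eq =
    cong₂ _∷_ (List.∷-injectiveˡ eq) (toList-injective (List.∷-injectiveʳ eq))

  drop-++ : ∀ {A : Set} (xs {ys} : List A) → List.drop (length xs) (xs ++ ys) ≡ ys
  drop-++ []       = refl
  drop-++ (x ∷ xs) = drop-++ xs

  ++-injective-length : ∀ {A : Set} {m} (xs ys : Vec A m) {xs′ ys′} →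
                        toList xs ++ xs′ ≡ toList ys ++ ys′ → xs ≡ ys × xs′ ≡ ys′
  ++-injective-length []       []       eq = refl , eq
  ++-injective-length (x ∷ xs) (y ∷ ys) eq =
    let p , q = ++-injective-length xs ys (List.∷-injectiveʳ eq)
    in cong₂ _∷_ (List.∷-injectiveˡ eq) p , q

  Increasing-interval : ∀ {n} m i (m+i≤n : m + i ≤ n) j l → j Fin.< l →
                        lookup (interval m i m+i≤n) j Fin.< lookup (interval m i m+i≤n) l
  Increasing-interval m i m+i≤n j l j<l = subst₂ _<_
    (sym (toℕ-interval m i m+i≤n j)) (sym (toℕ-interval m i m+i≤n l)) (ℕ.+-monoˡ-< i j<l)

  -- The way back from factorisations to positions, shared by both kinds of window: the block
  -- occupies the interval that starts at `length before`.
  module SplitInterval {n m} (π : Vec ℕ n) (before : List ℕ) (block : Vec ℕ (suc m)) {after}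
    (split : toList π ≡ before ++ toList block ++ after) where

    private
      i : ℕ
      i = length before

      bound : suc m + i ≤ n
      bound = begin
        suc m + i                                      ≡⟨ ℕ.+-comm (suc m) i ⟩
        i + suc m                                      ≤⟨ ℕ.+-monoʳ-≤ i (ℕ.m≤m+n (suc m) (length after)) ⟩
        i + (suc m + length after)
          ≡⟨ cong (λ c → i + (c + length after)) (Vec.length-toList block) ⟨
        i + (length (toList block) + length after)     ≡⟨ cong (i +_) (List.length-++ (toList block)) ⟨
        i + length (toList block ++ after)             ≡⟨ List.length-++ before ⟨
        length (before ++ toList block ++ after)       ≡⟨ cong length split ⟨
        length (toList π)                              ≡⟨ Vec.length-toList π ⟩
        n                                              ∎
        where open ℕ.≤-Reasoning

    is : Vec (Fin n) (suc m)
    is = interval (suc m) i bound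

    increasing : ∀ j l → j Fin.< l → lookup is j Fin.< lookup is l
    increasing = Increasing-interval (suc m) i bound

    adjacents : Adjacents is
    adjacents = adjacents-interval (suc m) i bound

    is-toℕ : ∀ j → toℕ (lookup is j) ≡ toℕ j + i
    is-toℕ = toℕ-interval (suc m) i bound

    private
      values×after : Vec.map (lookup π) is ≡ block × List.drop (suc m + i) (toList π) ≡ after
      -- The suffix of `π` that starts at `i` is factored in two ways, along the interval and by
      -- `split`. The first factors have equal length, so both factors agree.
      values×after = ++-injective-length (Vec.map (lookup π) is) block (begin
        toList (Vec.map (lookup π) is) ++ List.drop (suc m + i) (toList π)
          ≡⟨ cong (λ d → toList (Vec.map (lookup π) is) ++ List.drop (suc m + d) (toList π)) (is-toℕ Fin.zero) ⟨
        toList (Vec.map (lookup π) is) ++ List.drop (suc m + toℕ (lookup is Fin.zero)) (toList π)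
          ≡⟨ drop-adjacents π (lookup is Fin.zero) (Vec.tail is) adjacents ⟨
        List.drop (toℕ (lookup is Fin.zero)) (toList π)
          ≡⟨ cong₂ List.drop (is-toℕ Fin.zero) split ⟩
        List.drop i (before ++ toList block ++ after)
          ≡⟨ drop-++ before ⟩
        toList block ++ after ∎)
        where open ≡-Reasoning

    values : Vec.map (lookup π) is ≡ block
    values = proj₁ values×after

    after≡drop : List.drop (suc m + i) (toList π) ≡ after
    after≡drop = proj₂ values×after

  module _ {n m} (σ : Vec ℕ (suc m)) (π : Vec ℕ n) where

    occurrence⇒window : ∃ (IsOccurrence (consecutive σ) π) → Window σ (toList π)
    occurrence⇒window (i ∷ is , _ , adj , eq) = window
      (trans (sym (List.take++drop≡id (toℕ i) (toList π)))
        (cong (List.take (toℕ i) (toList π) ++_)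
          (drop-adjacents π i is (λ j l e → adj j l e (Vec.lookup-replicate l true)))))
      eq

    window⇒occurrence : Window σ (toList π) → ∃ (IsOccurrence (consecutive σ) π)
    window⇒occurrence (window {before} {after} {block} split matches) =
      is , increasing , (λ j l e _ → adjacents j l e) , trans (cong std values) matches
      where open SplitInterval π before block split

  count-∷ʳ : ∀ {m} a (w : Vec ℕ m) x →
             Vec.count (_<? a) (w ∷ʳ x) ≡ Vec.count (_<? a) w + (if does (x <? a) then 1 else 0)
  count-∷ʳ a [] x with does (x <? a)
  ... | true  = refl
  ... | false = refl
  count-∷ʳ a (b ∷ w) x with does (b <? a)
  ... | true  = cong suc (count-∷ʳ a w x)
  ... | false = count-∷ʳ a w x

  count-∷ʳ-≥ : ∀ {m} {a} (w : Vec ℕ m) {x} → a ≤ x → Vec.count (_<? a) (w ∷ʳ x) ≡ Vec.count (_<? a) w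
  count-∷ʳ-≥ {a = a} w {x} a≤x = begin
    Vec.count (_<? a) (w ∷ʳ x)                                    ≡⟨ count-∷ʳ a w x ⟩
    Vec.count (_<? a) w + (if does (x <? a) then 1 else 0)
      ≡⟨ cong (λ b → Vec.count (_<? a) w + (if b then 1 else 0)) (dec-false (x <? a) (ℕ.≤⇒≯ a≤x)) ⟩
    Vec.count (_<? a) w + 0                                       ≡⟨ ℕ.+-identityʳ _ ⟩
    Vec.count (_<? a) w                                           ∎
    where open ≡-Reasoning

  count-full⇒All : ∀ {m} x (w : Vec ℕ m) → Vec.count (_<? x) w ≡ m → VecAll.All (_< x) w
  count-full⇒All x []      _  = VecAll.[]
  count-full⇒All x (a ∷ w) eq with a ℕ.<ᵇ x | ℕ.<ᵇ⇒< a x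
  ... | true  | a<x = a<x _ VecAll.∷ count-full⇒All x w (ℕ.suc-injective eq)
  -- If `a` is not below `x`, at most `m` of the `suc m` letters are counted.
  ... | false | _   = contradiction (Vec.count≤n (_<? x) w) (ℕ.<⇒≱ (ℕ.≤-reflexive (sym eq)))

  All⇒count-full : ∀ {m} x {w : Vec ℕ m} → VecAll.All (_< x) w → Vec.count (_<? x) w ≡ m
  All⇒count-full x VecAll.[] = refl
  All⇒count-full x {a ∷ _} (a<x VecAll.∷ w<x) with a ℕ.<ᵇ x | ℕ.<⇒<ᵇ a<x
  ... | true | _ = cong suc (All⇒count-full x w<x)

  map-cong-All : ∀ {A B : Set} {P : A → Set} {f g : A → B} → (∀ {a} → P a → f a ≡ g a) →
                 ∀ {m} {w : Vec A m} → VecAll.All P w → Vec.map f w ≡ Vec.map g w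
  map-cong-All f≗g VecAll.[]         = refl
  map-cong-All f≗g (pa VecAll.∷ pas) = cong₂ _∷_ (f≗g pa) (map-cong-All f≗g pas)

  -- A letter above all others changes no other rank, and its own rank is one more than their
  -- number.
  std-∷ʳ : ∀ {m} {w : Vec ℕ m} {x} → VecAll.All (_< x) w → std (w ∷ʳ x) ≡ std w ∷ʳ suc m
  std-∷ʳ {m} {w} {x} w<x = trans (Vec.map-∷ʳ (λ a → suc (Vec.count (_<? a) (w ∷ʳ x))) x w)
    (cong₂ _∷ʳ_
      (map-cong-All (λ a<x → cong suc (count-∷ʳ-≥ w (ℕ.<⇒≤ a<x))) w<x)
      (cong suc (trans (count-∷ʳ-≥ w ℕ.≤-refl) (All⇒count-full x w<x))))

  -- The last letter does not count itself, so rank `suc m` forces all `m` letters before it to be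
  -- smaller.
  std-∷ʳ-last : ∀ {m} (w : Vec ℕ m) x {σ} → std (w ∷ʳ x) ≡ σ ∷ʳ suc m → VecAll.All (_< x) w
  std-∷ʳ-last w x eq = count-full⇒All x w (trans (sym (count-∷ʳ-≥ w ℕ.≤-refl))
    (ℕ.suc-injective (Vec.∷ʳ-injectiveʳ _ _ (trans
      (sym (Vec.map-∷ʳ (λ a → suc (Vec.count (_<? a) (w ∷ʳ x))) x w)) eq))))

  module _ {n m} (σ : Vec ℕ (suc m)) (π : Vec ℕ n) where

    private
      p : Vincular (suc (suc m))
      p = consecutive σ ▹ suc (suc m)

    occurrence⇒dominatedWindow : ∃ (IsOccurrence p π) → DominatedWindow σ (toList π)
    occurrence⇒dominatedWindow (is , inc , adj , eq) with Vec.initLast is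
    ... | i ∷ js , l , refl = dominatedWindow
      (trans (sym (List.take++drop≡id (toℕ i) (toList π)))
        (cong (List.take (toℕ i) (toList π) ++_) (drop-adjacents π i js adjs)))
      (Vec.∷ʳ-injectiveˡ _ _ (trans (sym (std-∷ʳ below)) std≡))
      (lose (lookup∈drop π l beyond) (VecAll.toList⁺ below))
      where
      w : Vec ℕ (suc m)
      w = Vec.map (lookup π) (i ∷ js)

      std≡ : std (w ∷ʳ lookup π l) ≡ σ ∷ʳ suc (suc m)
      std≡ = trans (cong std (sym (Vec.map-∷ʳ (lookup π) l (i ∷ js)))) eq

      below : VecAll.All (_< lookup π l) w
      below = std-∷ʳ-last w (lookup π l) std≡

      adjs : Adjacents (i ∷ js)
      adjs j l′ e = subst₂ (λ a b → toℕ a ≡ suc (toℕ b))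
        (lookup-∷ʳ-inject₁ (i ∷ js) l l′) (lookup-∷ʳ-inject₁ (i ∷ js) l j)
        (adj (inject₁ j) (inject₁ l′)
          (trans (Fin.toℕ-inject₁ l′) (trans e (cong suc (sym (Fin.toℕ-inject₁ j)))))
          (trans (lookup-∷ʳ-inject₁ (Vec.replicate (suc m) true) false l′) (Vec.lookup-replicate l′ true)))

      -- The last position of the block is `m + toℕ i`, and increasing positions put `l` strictly
      -- after it. So the final letter lies in the remainder given by `drop-adjacents`.
      beyond : suc m + toℕ i ≤ toℕ l
      beyond = begin
        suc m + toℕ i                             ≡⟨ cong (λ c → suc (c + toℕ i)) (Fin.toℕ-fromℕ m) ⟨
        suc (toℕ (fromℕ m) + toℕ i)               ≡⟨ cong suc (adjacents-toℕ i js adjs (fromℕ m)) ⟨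
        suc (toℕ (lookup (i ∷ js) (fromℕ m)))     ≡⟨ cong (suc ∘ toℕ) (lookup-∷ʳ-inject₁ (i ∷ js) l (fromℕ m)) ⟨
        suc (toℕ (lookup ((i ∷ js) ∷ʳ l) (inject₁ (fromℕ m))))
          ≤⟨ inc (inject₁ (fromℕ m)) (fromℕ (suc m)) (s≤s (ℕ.≤-reflexive (Fin.toℕ-inject₁ (fromℕ m)))) ⟩
        toℕ (lookup ((i ∷ js) ∷ʳ l) (fromℕ (suc m))) ≡⟨ cong toℕ (lookup-∷ʳ-fromℕ (i ∷ js) l) ⟩
        toℕ l                                      ∎
        where open ℕ.≤-Reasoning

    dominatedWindow⇒occurrence : DominatedWindow σ (toList π) → ∃ (IsOccurrence p π)
    dominatedWindow⇒occurrence (dominatedWindow {before} {after} {block} split matches dominated)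
      with find dominated
    ... | x , x∈after , block<x = result
      where
      open SplitInterval π before block split

      last : ∃ λ l → suc m + length before ≤ toℕ l × lookup π l ≡ x
      last = ∈drop⇒lookup π (suc m + length before) (subst (x ∈_) (sym after≡drop) x∈after)

      l : Fin n
      l = proj₁ last

      increasing′ : ∀ j j′ → j Fin.< j′ → lookup (is ∷ʳ l) j Fin.< lookup (is ∷ʳ l) j′
      increasing′ j j′ j<j′ with view j | view j′
      ... | ‵fromℕ     | _ = contradiction j<j′ (ℕ.≤⇒≯
        (subst (toℕ j′ ≤_) (sym (Fin.toℕ-fromℕ (suc m))) (ℕ.s≤s⁻¹ (Fin.toℕ<n j′))))
      ... | ‵inject₁ i | ‵inject₁ i′ = subst₂ Fin._<_
        (sym (lookup-∷ʳ-inject₁ is l i)) (sym (lookup-∷ʳ-inject₁ is l i′))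
        (increasing i i′ (subst₂ _<_ (Fin.toℕ-inject₁ i) (Fin.toℕ-inject₁ i′) j<j′))
      ... | ‵inject₁ i | ‵fromℕ = subst₂ Fin._<_
        (sym (lookup-∷ʳ-inject₁ is l i)) (sym (lookup-∷ʳ-fromℕ is l))
        (ℕ.<-≤-trans (subst (_< suc m + length before) (sym (is-toℕ i))
          (ℕ.+-monoˡ-< (length before) (Fin.toℕ<n i))) (proj₁ (proj₂ last)))

      adjacent′ : Adjacent p π (is ∷ʳ l)
      adjacent′ j j′ e joined with view j | view j′
      -- The appended letter is not underlined, so `joined` would claim that `false` is `true`.
      ... | _ | ‵fromℕ = contradiction
        (trans (sym (lookup-∷ʳ-fromℕ (Vec.replicate (suc m) true) false)) joined) λ ()
      ... | ‵fromℕ | ‵inject₁ i′ = contradiction (Fin.toℕ<n i′) (ℕ.≤⇒≯ (begin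
        suc m                   ≡⟨ Fin.toℕ-fromℕ (suc m) ⟨
        toℕ (fromℕ (suc m))     ≤⟨ ℕ.n≤1+n _ ⟩
        suc (toℕ (fromℕ (suc m))) ≡⟨ e ⟨
        toℕ (inject₁ i′)        ≡⟨ Fin.toℕ-inject₁ i′ ⟩
        toℕ i′                  ∎))
        where open ℕ.≤-Reasoning
      ... | ‵inject₁ i | ‵inject₁ i′ = subst₂ (λ a b → toℕ a ≡ suc (toℕ b))
        (sym (lookup-∷ʳ-inject₁ is l i′)) (sym (lookup-∷ʳ-inject₁ is l i))
        (adjacents i i′ (trans (sym (Fin.toℕ-inject₁ i′)) (trans e (cong suc (Fin.toℕ-inject₁ i)))))

      result : ∃ (IsOccurrence p π)
      result = is ∷ʳ l , increasing′ , adjacent′ , (begin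
        std (Vec.map (lookup π) (is ∷ʳ l))          ≡⟨ cong std (Vec.map-∷ʳ (lookup π) l is) ⟩
        std (Vec.map (lookup π) is ∷ʳ lookup π l)
          ≡⟨ cong₂ (λ v y → std (v ∷ʳ y)) values (proj₂ (proj₂ last)) ⟩
        std (block ∷ʳ x)                            ≡⟨ std-∷ʳ (VecAll.toList⁻ block<x) ⟩
        std block ∷ʳ suc (suc m)                    ≡⟨ cong (_∷ʳ suc (suc m)) matches ⟩
        σ ∷ʳ suc (suc m)                            ∎)
        where open ≡-Reasoning

  -- Splitting at the largest letter

  -- Levi's lemma: of two prefixes of the same word, one extends the other.
  ++-split : ∀ {A : Set} (xs : List A) {ys} zs {ws} → xs ++ ys ≡ zs ++ ws →
             (∃ λ d → zs ≡ xs ++ d × ys ≡ d ++ ws) ⊎ (∃ λ d → xs ≡ zs ++ d × ws ≡ d ++ ys)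
  ++-split []       zs       eq = inj₁ (zs , refl , eq)
  ++-split (x ∷ xs) []       eq = inj₂ (x ∷ xs , refl , sym eq)
  ++-split (x ∷ xs) (z ∷ zs) eq with List.∷-injective eq
  ... | refl , eq′ with ++-split xs zs eq′
  ...   | inj₁ (d , p , q) = inj₁ (d , cong (x ∷_) p , q)
  ...   | inj₂ (d , p , q) = inj₂ (d , cong (x ∷_) p , q)

  module _ {m} {σ : Vec ℕ m} {L R : List ℕ} {M} (L<M : All (_< M) L) (R<M : All (_< M) R) where

    window-left : Window σ L → DominatedWindow σ (L ++ M ∷ R)
    window-left (window {before} {after} {block} refl matches) = dominatedWindow {before = before} {block = block}
      (trans (List.++-assoc before (toList block ++ after) (M ∷ R))
        (cong (before ++_) (List.++-assoc (toList block) after (M ∷ R))))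
      matches
      (Any.++⁺ʳ after (here (All.++⁻ˡ (toList block) (All.++⁻ʳ before L<M))))

    window-right : DominatedWindow σ R → DominatedWindow σ (L ++ M ∷ R)
    window-right (dominatedWindow {before} split matches dominated) = dominatedWindow {before = L ++ M ∷ before}
      (trans (cong (λ R → L ++ M ∷ R) split) (sym (List.++-assoc L (M ∷ before) _)))
      matches dominated

    -- The end of the block is compared with the end of `L`. A block that ends inside `L` is a
    -- window of `L`. Otherwise the dominating letter lies in `R` and is below `M`, so `M` is not in
    -- the block, and the block starts after `M`.
    window-split : DominatedWindow σ (L ++ M ∷ R) → Window σ L ⊎ DominatedWindow σ R
    window-split (dominatedWindow {before} {after} {block} split matches dominated)
      with ++-split L (before ++ toList block) (trans split (sym (List.++-assoc before (toList block) after)))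
    ... | inj₂ (d , L≡ , _) =
      inj₁ (window {before = before} {d} (trans L≡ (List.++-assoc before (toList block) d)) matches)
    -- The block ends exactly where `L` does, and `M` starts the remainder.
    ... | inj₁ ([] , ≡L , _) =
      inj₁ (window {before = before} {[]} (trans (sym (trans ≡L (List.++-identityʳ L)))
                   (cong (before ++_) (sym (List.++-identityʳ (toList block))))) matches)
    ... | inj₁ (M′ ∷ d , ≡L , M∷R≡) with List.∷-injective M∷R≡
    ...   | refl , R≡ = inj₂ (later (++-split L before (sym ≡L)))
      where
      M∉block : M ∉ toList block
      M∉block M∈ with find dominated
      ... | x , x∈after , block<x = ℕ.<-asym (All.lookup block<x M∈)
        (All.lookup (All.++⁻ʳ d (subst (All (_< M)) R≡ R<M)) x∈after)

      later : _ → DominatedWindow σ R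
      -- Here `M` would be the first letter of the block; in the last case below it would be a later
      -- one. Only a prefix `before` that reaches past `M` survives.
      later (inj₁ ([] , _ , M∷d≡)) = contradiction (subst (M ∈_) M∷d≡ (here refl)) M∉block
      later (inj₁ (M″ ∷ e , _ , M∷d≡)) = dominatedWindow {before = e}
        (trans R≡ (trans (cong (_++ after) (List.∷-injectiveʳ M∷d≡)) (List.++-assoc e (toList block) after)))
        matches dominated
      later (inj₂ (e , _ , block≡)) =
        contradiction (subst (M ∈_) (sym block≡) (∈-++⁺ʳ e (here refl))) M∉block

  desˡ : List ℕ → ℕ
  desˡ = des ∘ fromList

  desˡ-toList : ∀ {n} (v : Vec ℕ n) → desˡ (toList v) ≡ des v
  desˡ-toList []          = refl
  desˡ-toList (a ∷ [])    = refl
  desˡ-toList (a ∷ b ∷ v) = cong (_ +_) (desˡ-toList (b ∷ v))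

  -- The step from the end of `L` up to `M` is an ascent, so the cut loses no descent. `M` stays
  -- with `R`, where its descent depends on whether `R` is empty.
  desˡ-split : ∀ {L M} R → All (_< M) L → desˡ (L ++ M ∷ R) ≡ desˡ L + desˡ (M ∷ R)
  desˡ-split R [] = refl
  desˡ-split {a ∷ []} {M} R (a<M ∷ []) = cong (λ b → (if b then 1 else 0) + desˡ (M ∷ R))
    (dec-false (M <? a) (ℕ.<-asym a<M))
  desˡ-split {a ∷ b ∷ L} {M} R (_ ∷ b∷L<M) =
    trans (cong (_ +_) (desˡ-split {b ∷ L} R b∷L<M))
      (sym (ℕ.+-assoc (if does (b <? a) then 1 else 0) (desˡ (b ∷ L)) _))

  desˡ-∷-max : ∀ {M r} R → r < M → desˡ (M ∷ r ∷ R) ≡ suc (desˡ (r ∷ R))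
  desˡ-∷-max {M} {r} R r<M = cong (λ b → (if b then 1 else 0) + desˡ (r ∷ R)) (dec-true (r <? M) r<M)

  -- Words over an alphabet

  Unique-resp-↭ : ∀ {xs ys : List ℕ} → xs ↭ ys → Unique xs → Unique ys
  Unique-resp-↭ xs↭ys = ↭Setoid.Unique-resp-↭ (setoid ℕ) (↭.↭⇒↭ₛ xs↭ys)

  -- A pigeonhole argument: the first entry of `xs` is cut out of `ys`, and by distinctness the
  -- remaining entries stay within what is left. It identifies the repetition-free words of full
  -- length with the rearrangements of the alphabet.
  unique-⊆⇒↭ : ∀ {A : Set} {xs ys : List A} → Unique xs → (∀ {a} → a ∈ xs → a ∈ ys) →
               length xs ≡ length ys → xs ↭ ys
  unique-⊆⇒↭ {xs = []}     {[]}    []           _     _  = ↭-refl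
  unique-⊆⇒↭ {xs = x ∷ xs} (x∉xs ∷ xs!) xs⊆ys eq with ∈-∃++ (xs⊆ys (here refl))
  ... | ys₁ , ys₂ , refl = ↭-trans (↭-prep x (unique-⊆⇒↭ xs! inside length≡)) (↭-sym (↭.shift x ys₁ ys₂))
    where
    inside : ∀ {a} → a ∈ xs → a ∈ ys₁ ++ ys₂
    inside a∈xs with ↭.∈-resp-↭ (↭.shift x ys₁ ys₂) (xs⊆ys (there a∈xs))
    ... | here refl = contradiction refl (All.lookup x∉xs a∈xs)
    ... | there a∈  = a∈

    length≡ : length xs ≡ length (ys₁ ++ ys₂)
    length≡ = ℕ.suc-injective (trans eq (↭.↭-length (↭.shift x ys₁ ys₂)))

  toList-Unique⁺ : ∀ {n} {v : Vec ℕ n} → VecUnique.Unique v → Unique (toList v)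
  toList-Unique⁺ VecAllPairs.[]         = []
  toList-Unique⁺ (a∉v VecAllPairs.∷ v!) = VecAll.toList⁺ a∉v ∷ toList-Unique⁺ v!

  toList-Unique⁻ : ∀ {n} {v : Vec ℕ n} → Unique (toList v) → VecUnique.Unique v
  toList-Unique⁻ {v = []}    []         = VecAllPairs.[]
  toList-Unique⁻ {v = a ∷ v} (a∉v ∷ v!) = VecAll.toList⁻ a∉v VecAllPairs.∷ toList-Unique⁻ {v = v} v!

  ∈-words⁺ : ∀ {as n} (v : Vec ℕ n) → (∀ {a} → a ∈ toList v → a ∈ as) → v ∈ words as n
  ∈-words⁺ []      _    = here refl
  ∈-words⁺ (a ∷ v) v⊆as = ∈-cartesianProductWith⁺ _∷_ (v⊆as (here refl)) (∈-words⁺ v (v⊆as ∘ there))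

  ∈-words⁻ : ∀ {as n} {v : Vec ℕ n} → v ∈ words as n → ∀ {a} → a ∈ toList v → a ∈ as
  ∈-words⁻ {as} {suc n} v∈ with ∈-cartesianProductWith⁻ _∷_ as (words as n) v∈
  ... | b , v′ , b∈as , v′∈ , refl = λ where
    (here refl) → b∈as
    (there a∈)  → ∈-words⁻ v′∈ a∈
  ∈-words⁻ {n = zero} (here refl) ()

  words-unique : ∀ {as} n → Unique as → Unique (words as n)
  words-unique zero    _   = All.[] AllPairs.∷ AllPairs.[]
  words-unique (suc n) as! =
    Unique.cartesianProductWith⁺ {A = ℕ} {B = Vec ℕ n} {C = Vec ℕ (suc n)} _∷_ Vec.∷-injective
      as! (words-unique n as!)

  arrangements : ∀ {k} → Vincular k → List ℕ → ∀ n → List (Vec ℕ n)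
  arrangements ω as n = List.filter (avoids? ω) (List.filter unique? (words as n))

  -- Opaque because unification would otherwise unfold the enumeration.
  opaque
    avoiders : ∀ {k} → Vincular k → List ℕ → List (List ℕ)
    avoiders ω as = List.map toList (arrangements ω as (length as))

  opaque
    unfolding avoiders

    avoiders-unique : ∀ {k} (ω : Vincular k) {as} → Unique as → Unique (avoiders ω as)
    avoiders-unique ω {as} as! = Unique.map⁺ {f = toList} toList-injective
      (Unique.filter⁺ (avoids? ω) (Unique.filter⁺ unique? (words-unique (length as) as!)))

  -- Abstracting over the list form of an occurrence lets one argument serve both `Window` and
  -- `DominatedWindow`.
  module _ {k} (ω : Vincular k) (Occurs : List ℕ → Set)
    (occurs⁺ : ∀ {n} (π : Vec ℕ n) → ∃ (IsOccurrence ω π) → Occurs (toList π))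
    (occurs⁻ : ∀ {n} (π : Vec ℕ n) → Occurs (toList π) → ∃ (IsOccurrence ω π))
    {as : List ℕ} where

    opaque
      unfolding avoiders

      ∈-avoiders⁻ : ∀ {w} → w ∈ avoiders ω as → w ↭ as × ¬ Occurs w
      ∈-avoiders⁻ w∈ with ∈-map⁻ toList w∈
      ... | v , v∈ , refl =
        let v∈′ , avoids = ∈-filter⁻ (avoids? ω) {xs = List.filter unique? (words as (length as))} v∈
            v∈″ , v!     = ∈-filter⁻ unique? {xs = words as (length as)} v∈′
        in unique-⊆⇒↭ (toList-Unique⁺ v!) (∈-words⁻ v∈″) (Vec.length-toList v)
         , avoids ∘ occurs⁻ v

      ∈-avoiders⁺ : Unique as → ∀ {w} → w ↭ as → ¬ Occurs w → w ∈ avoiders ω as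
      ∈-avoiders⁺ as! {w} w↭as avoids = subst (λ n → w ∈ List.map toList (arrangements ω as n))
        (↭.↭-length w↭as)
        (subst (_∈ List.map toList (arrangements ω as (length w))) (Vec.toList∘fromList w)
          (∈-map⁺ toList (∈-filter⁺ (avoids? ω)
            (∈-filter⁺ unique?
              (∈-words⁺ (fromList w) (↭.∈-resp-↭ w↭as ∘ subst (_ ∈_) (Vec.toList∘fromList w)))
              (toList-Unique⁻ {v = fromList w}
                (subst Unique (sym (Vec.toList∘fromList w)) (Unique-resp-↭ (↭-sym w↭as) as!))))
            (avoids ∘ subst Occurs (Vec.toList∘fromList w) ∘ occurs⁺ (fromList w)))))

  opaque
    unfolding avoiders

    avoiders≡arrangements : ∀ {k} (ω : Vincular k) as →
                            avoiders ω as ≡ List.map toList (arrangements ω as (length as))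
    avoiders≡arrangements ω as = refl

  -- Cutting an avoider at its largest letter

  -- The ways to distribute the alphabet over the two sides. Each part keeps the order of the
  -- alphabet, so a set of letters has one representative and sortedness is inherited.
  splits : List ℕ → List (List ℕ × List ℕ)
  splits []       = ([] , []) ∷ []
  splits (a ∷ as) = List.map (map₁ (a ∷_)) (splits as) ++ List.map (map₂ (a ∷_)) (splits as)

  ∈-splits-∷⁻ : ∀ {a as l r} → (l , r) ∈ splits (a ∷ as) →
                (∃ λ l′ → l ≡ a ∷ l′ × (l′ , r) ∈ splits as) ⊎ (∃ λ r′ → r ≡ a ∷ r′ × (l , r′) ∈ splits as)
  ∈-splits-∷⁻ {a} {as} s∈ with ∈-++⁻ (List.map (map₁ (a ∷_)) (splits as)) s∈
  ... | inj₁ s∈ˡ with ∈-map⁻ (map₁ (a ∷_)) s∈ˡ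
  ...   | (l′ , r) , s′∈ , refl = inj₁ (l′ , refl , s′∈)
  ∈-splits-∷⁻ {a} {as} s∈ | inj₂ s∈ʳ with ∈-map⁻ (map₂ (a ∷_)) s∈ʳ
  ... | (l , r′) , s′∈ , refl = inj₂ (r′ , refl , s′∈)

  splits-↭ : ∀ {as l r} → (l , r) ∈ splits as → l ++ r ↭ as
  splits-↭ {[]}     (here refl) = ↭-refl
  splits-↭ {a ∷ as} s∈ with ∈-splits-∷⁻ {as = as} s∈
  ... | inj₁ (l , refl , s′∈)         = ↭-prep a (splits-↭ s′∈)
  ... | inj₂ (r , refl , s′∈) = ↭-trans (↭.shift a _ r) (↭-prep a (splits-↭ s′∈))

  splits-⊆ˡ : ∀ {as l r} → (l , r) ∈ splits as → ∀ {a} → a ∈ l → a ∈ as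
  splits-⊆ˡ s∈ a∈l = ↭.∈-resp-↭ (splits-↭ s∈) (∈-++⁺ˡ a∈l)

  splits-⊆ʳ : ∀ {as l r} → (l , r) ∈ splits as → ∀ {a} → a ∈ r → a ∈ as
  splits-⊆ʳ {l = l} s∈ a∈r = ↭.∈-resp-↭ (splits-↭ s∈) (∈-++⁺ʳ l a∈r)

  splits-sorted : ∀ {as l r} → AllPairs _<_ as → (l , r) ∈ splits as → AllPairs _<_ l × AllPairs _<_ r
  splits-sorted {[]} [] (here refl) = [] , []
  splits-sorted {a ∷ as} (a<as ∷ as<) s∈ with ∈-splits-∷⁻ {as = as} s∈
  ... | inj₁ (l , refl , s′∈) = map₁ (All.tabulate (All.lookup a<as ∘ splits-⊆ˡ s′∈) ∷_) (splits-sorted as< s′∈)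
  ... | inj₂ (r , refl , s′∈) = map₂ (All.tabulate (All.lookup a<as ∘ splits-⊆ʳ s′∈) ∷_) (splits-sorted as< s′∈)

  splits-complete : ∀ {as} L R → L ++ R ↭ as → ∃₂ λ l r → (l , r) ∈ splits as × L ↭ l × R ↭ r
  splits-complete {[]} L R LR↭ = [] , [] , here refl
    , ↭-reflexive (List.++-conicalˡ L R (↭.↭-empty-inv LR↭))
    , ↭-reflexive (List.++-conicalʳ L R (↭.↭-empty-inv LR↭))
  splits-complete {a ∷ as} L R LR↭ with ∈-++⁻ L (↭.∈-resp-↭ (↭-sym LR↭) (here refl))
  ... | inj₁ a∈L with ∈-∃++ a∈L
  ...   | L₁ , L₂ , refl =
    let l , r , s∈ , L↭ , R↭ = splits-complete (L₁ ++ L₂) R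
          (↭.drop-∷ (↭-trans (↭-sym (↭.++⁺ʳ R (↭.shift a L₁ L₂))) LR↭))
    in a ∷ l , r , ∈-++⁺ˡ (∈-map⁺ (map₁ (a ∷_)) s∈) , ↭-trans (↭.shift a L₁ L₂) (↭-prep a L↭) , R↭
  splits-complete {a ∷ as} L R LR↭ | inj₂ a∈R with ∈-∃++ a∈R
  ... | R₁ , R₂ , refl =
    let l , r , s∈ , L↭ , R↭ = splits-complete L (R₁ ++ R₂)
          (↭.drop-∷ (↭-trans (↭-sym (↭-trans (↭.++⁺ˡ L (↭.shift a R₁ R₂)) (↭.shift a L (R₁ ++ R₂)))) LR↭))
    in l , a ∷ r , ∈-++⁺ʳ (List.map (map₁ (a ∷_)) (splits as)) (∈-map⁺ (map₂ (a ∷_)) s∈)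
       , L↭ , ↭-trans (↭.shift a R₁ R₂) (↭-prep a R↭)

  -- Distinctness is needed up to rearrangement, since each left part stands for all words on its
  -- letters. Parts that received `a` differ from those that did not, and the rest is induction.
  splits-distinct : ∀ {as} → Unique as → AllPairs (λ s s′ → ¬ (proj₁ s ↭ proj₁ s′)) (splits as)
  splits-distinct []                    = [] ∷ []
  splits-distinct {a ∷ as} (a∉as ∷ as!) = AllPairs.++⁺
    (AllPairs.map⁺ (AllPairs.map (_∘ ↭.drop-∷) (splits-distinct as!)))
    (AllPairs.map⁺ (splits-distinct as!))
    (All.map⁺ (All.tabulate λ _ → All.map⁺ (All.tabulate λ s∈ a∷l↭l′ →
      All.lookup a∉as (splits-⊆ˡ s∈ (↭.∈-resp-↭ a∷l↭l′ (here refl))) refl)))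

  -- Injectivity is asked on the members only: `join M` can be undone when `M` does not occur in the
  -- left part, but not for arbitrary pairs.
  map-unique : ∀ {A B : Set} {f : A → B} {xs} → (∀ {x y} → x ∈ xs → y ∈ xs → f x ≡ f y → x ≡ y) →
               Unique xs → Unique (List.map f xs)
  map-unique inj []           = []
  map-unique inj (x∉xs ∷ xs!) =
    All.map⁺ (All.tabulate λ y∈ fx≡fy → All.lookup x∉xs y∈ (inj (here refl) (there y∈) fx≡fy))
    ∷ map-unique (λ x∈ y∈ → inj (there x∈) (there y∈)) xs!

  ∷-split-unique : ∀ {A : Set} {M : A} {L L′ R R′} → M ∉ L → M ∉ L′ → L ++ M ∷ R ≡ L′ ++ M ∷ R′ →
                   L ≡ L′ × R ≡ R′
  ∷-split-unique {L = []}    {[]}     _   _    eq = refl , List.∷-injectiveʳ eq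
  ∷-split-unique {L = []}    {b ∷ L′} _   M∉L′ eq = contradiction (here (List.∷-injectiveˡ eq)) M∉L′
  ∷-split-unique {L = a ∷ L} {[]}     M∉L _    eq = contradiction (here (sym (List.∷-injectiveˡ eq))) M∉L
  ∷-split-unique {L = a ∷ L} {b ∷ L′} M∉L M∉L′ eq =
    let p , q = ∷-split-unique (M∉L ∘ there) (M∉L′ ∘ there) (List.∷-injectiveʳ eq)
    in cong₂ _∷_ (List.∷-injectiveˡ eq) p , q

  -- The largest letter M of a p-avoider cuts it into a σ-avoider and a p-avoider.
  module Decomposition {m} (σ : Vec ℕ (suc m)) where

    c : Vincular (suc m)
    c = consecutive σ

    p : Vincular (suc (suc m))
    p = c ▹ suc (suc m)

    pairs : List ℕ × List ℕ → List (List ℕ × List ℕ)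
    pairs (l , r) = List.cartesianProduct (avoiders c l) (avoiders p r)

    join : ℕ → List ℕ × List ℕ → List ℕ
    join M (L , R) = L ++ M ∷ R

    ∈c⁻ : ∀ {as w} → w ∈ avoiders c as → w ↭ as × ¬ Window σ w
    ∈c⁻ = ∈-avoiders⁻ c (Window σ) (occurrence⇒window σ) (window⇒occurrence σ)

    ∈c⁺ : ∀ {as} → Unique as → ∀ {w} → w ↭ as → ¬ Window σ w → w ∈ avoiders c as
    ∈c⁺ = ∈-avoiders⁺ c (Window σ) (occurrence⇒window σ) (window⇒occurrence σ)

    ∈p⁻ : ∀ {as w} → w ∈ avoiders p as → w ↭ as × ¬ DominatedWindow σ w
    ∈p⁻ = ∈-avoiders⁻ p (DominatedWindow σ) (occurrence⇒dominatedWindow σ) (dominatedWindow⇒occurrence σ)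

    ∈p⁺ : ∀ {as} → Unique as → ∀ {w} → w ↭ as → ¬ DominatedWindow σ w → w ∈ avoiders p as
    ∈p⁺ = ∈-avoiders⁺ p (DominatedWindow σ) (occurrence⇒dominatedWindow σ) (dominatedWindow⇒occurrence σ)

    module _ {as : List ℕ} (as< : AllPairs _<_ as) where

      private
        as! : Unique as
        as! = AllPairs.map ℕ.<⇒≢ as<

        split-unique : ∀ {l r} → (l , r) ∈ splits as → Unique l × Unique r
        split-unique s∈ = let l< , r< = splits-sorted as< s∈ in
          AllPairs.map ℕ.<⇒≢ l< , AllPairs.map ℕ.<⇒≢ r<

        ∈-pairs⁻ : ∀ l r {L R} → (L , R) ∈ pairs (l , r) → L ∈ avoiders c l × R ∈ avoiders p r
        ∈-pairs⁻ l r = ∈-cartesianProduct⁻ (avoiders c l) (avoiders p r)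

      pairs-unique : Unique (List.concatMap pairs (splits as))
      pairs-unique = Unique.concat⁺ {xss = List.map pairs (splits as)}
        (All.map⁺ (All.tabulate (λ {s} → each s)))
        (AllPairs.map⁺ (AllPairs.map (λ {s} {s′} → disjoint s s′) (splits-distinct as!)))
        where
        each : ∀ s → s ∈ splits as → Unique (pairs s)
        each (l , r) s∈ = Unique.cartesianProduct⁺
          (avoiders-unique c (proj₁ (split-unique s∈))) (avoiders-unique p (proj₂ (split-unique s∈)))

        -- A common `L` would be a rearrangement of both left alphabets.
        disjoint : ∀ s s′ → ¬ (proj₁ s ↭ proj₁ s′) → Disjoint (pairs s) (pairs s′)
        disjoint (l , r) (l′ , r′) ¬l↭l′ {L , R} (LR∈ , LR∈′) = ¬l↭l′ (↭-trans
          (↭-sym (proj₁ (∈c⁻ {l} (proj₁ (∈-pairs⁻ l r LR∈)))))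
          (proj₁ (∈c⁻ {l′} (proj₁ (∈-pairs⁻ l′ r′ LR∈′)))))

      ∈-concatMap-pairs⁻ : ∀ {L R} → (L , R) ∈ List.concatMap pairs (splits as) →
        ∃₂ λ l r → (l , r) ∈ splits as × L ∈ avoiders c l × R ∈ avoiders p r
      ∈-concatMap-pairs⁻ {L} {R} LR∈ =
        let _ , LR∈′ , block∈  = ∈-concat⁻′ (List.map pairs (splits as)) LR∈
            (l , r) , s∈ , eq = ∈-map⁻ pairs block∈
        in l , r , s∈ , ∈-pairs⁻ l r (subst ((L , R) ∈_) eq LR∈′)

      module _ {M} (as<M : All (_< M) as) where

        private
          below : ∀ {l w} → (∀ {a} → a ∈ l → a ∈ as) → w ↭ l → All (_< M) w
          below l⊆as w↭l = All.tabulate (All.lookup as<M ∘ l⊆as ∘ ↭.∈-resp-↭ w↭l)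

          M∉ : ∀ {w} → All (_< M) w → M ∉ w
          M∉ w<M M∈w = ℕ.<-irrefl refl (All.lookup w<M M∈w)

          pair-below : ∀ {L R} → (L , R) ∈ List.concatMap pairs (splits as) → All (_< M) L × All (_< M) R
          pair-below LR∈ with ∈-concatMap-pairs⁻ LR∈
          ... | l , r , s∈ , L∈ , R∈ =
            below (splits-⊆ˡ s∈) (proj₁ (∈c⁻ {l} L∈)) , below (splits-⊆ʳ s∈) (proj₁ (∈p⁻ {r} R∈))

        -- Both lists are free of repetitions and have the same members, hence agree up to order.
        -- The alphabet is given up to rearrangement because the increasing listing of 1, ..., n + 1
        -- puts `M` last, not first.
        avoiders-join : ∀ {ls} → ls ↭ M ∷ as →
                        avoiders p ls ↭ List.map (join M) (List.concatMap pairs (splits as))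
        avoiders-join {ls} ls↭ = ∼bag⇒↭ (unique∧set⇒bag (avoiders-unique p ls!)
          (map-unique join-injective pairs-unique) (mk⇔ cut glue))
          where
          ls! : Unique ls
          ls! = Unique-resp-↭ (↭-sym ls↭)
            (All.map (λ a<M M≡a → ℕ.<-irrefl (sym M≡a) a<M) as<M ∷ as!)

          join-injective : ∀ {x y} → x ∈ List.concatMap pairs (splits as) →
                           y ∈ List.concatMap pairs (splits as) → join M x ≡ join M y → x ≡ y
          join-injective x∈ y∈ eq =
            let p , q = ∷-split-unique (M∉ (proj₁ (pair-below x∈))) (M∉ (proj₁ (pair-below y∈))) eq
            in cong₂ _,_ p q

          cut : ∀ {w} → w ∈ avoiders p ls → w ∈ List.map (join M) (List.concatMap pairs (splits as))
          cut w∈ with ∈p⁻ {ls} w∈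
          ... | w↭ls , avoids with ∈-∃++ (↭.∈-resp-↭ (↭-sym (↭-trans w↭ls ls↭)) (here refl))
          ...   | L , R , refl with splits-complete L R
                  (↭.drop-∷ (↭-trans (↭-sym (↭.shift M L R)) (↭-trans w↭ls ls↭)))
          ...     | l , r , s∈ , L↭ , R↭ = ∈-map⁺ (join M) (∈-concat⁺′
            (∈-cartesianProduct⁺
              (∈c⁺ (proj₁ (split-unique s∈)) L↭ (avoids ∘ window-left L<M R<M))
              (∈p⁺ (proj₂ (split-unique s∈)) R↭ (avoids ∘ window-right L<M R<M)))
            (∈-map⁺ pairs s∈))
            where
            L<M : All (_< M) L
            L<M = below (splits-⊆ˡ s∈) L↭

            R<M : All (_< M) R
            R<M = below (splits-⊆ʳ s∈) R↭

          glue : ∀ {w} → w ∈ List.map (join M) (List.concatMap pairs (splits as)) → w ∈ avoiders p ls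
          glue w∈ with ∈-map⁻ (join M) w∈
          ... | (L , R) , LR∈ , refl with ∈-concatMap-pairs⁻ LR∈
          ...   | l , r , s∈ , L∈ , R∈ = ∈p⁺ ls!
            (↭-trans (↭.shift M L R) (↭-trans (↭-prep M (↭-trans
              (↭.++⁺ (proj₁ (∈c⁻ {l} L∈)) (proj₁ (∈p⁻ {r} R∈))) (splits-↭ s∈))) (↭-sym ls↭)))
            ([ proj₂ (∈c⁻ {l} L∈) , proj₂ (∈p⁻ {r} R∈) ]′ ∘
              window-split (proj₁ (pair-below LR∈)) (proj₂ (pair-below LR∈)))

  -- Relabelling by increasing maps

  filter-map : ∀ {A B : Set} {P : Pred B 0ℓ} {Q : Pred A 0ℓ}
               (P? : Decidable P) (Q? : Decidable Q) {f : A → B} →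
               (∀ x → P (f x) ⇔ Q x) → ∀ xs → List.filter P? (List.map f xs) ≡ List.map f (List.filter Q? xs)
  filter-map P? Q? P⇔Q []       = refl
  filter-map P? Q? {f} P⇔Q (x ∷ xs) with P? (f x) | Q? x
  ... | yes _ | yes _ = cong (f x ∷_) (filter-map P? Q? P⇔Q xs)
  ... | no  _ | no  _ = filter-map P? Q? P⇔Q xs
  ... | yes p | no ¬q = contradiction (Equivalence.to (P⇔Q x) p) ¬q
  ... | no ¬p | yes q = contradiction (Equivalence.from (P⇔Q x) q) ¬p

  module Relabelling (f : ℕ → ℕ) (f-mono : ∀ {i j} → i < j → f i < f j) where

    f-cancel : ∀ {i j} → f i < f j → i < j
    f-cancel {i} {j} fi<fj with i <? j
    ... | yes i<j = i<j
    ... | no  i≮j with ℕ.m≤n⇒m<n∨m≡n (ℕ.≮⇒≥ i≮j)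
    ...   | inj₁ j<i  = contradiction (f-mono j<i) (ℕ.<-asym fi<fj)
    ...   | inj₂ refl = contradiction fi<fj (ℕ.<-irrefl refl)

    f-injective : ∀ {i j} → f i ≡ f j → i ≡ j
    f-injective {i} {j} eq with ℕ.<-cmp i j
    ... | tri< i<j _ _ = contradiction eq (ℕ.<⇒≢ (f-mono i<j))
    ... | tri≈ _ i≡j _ = i≡j
    ... | tri> _ _ j<i = contradiction (sym eq) (ℕ.<⇒≢ (f-mono j<i))

    does-<? : ∀ a b → does (f a <? f b) ≡ does (a <? b)
    does-<? a b = does-⇔ (mk⇔ f-cancel f-mono) (f a <? f b) (a <? b)

    count-map : ∀ {n} a (w : Vec ℕ n) → Vec.count (_<? f a) (Vec.map f w) ≡ Vec.count (_<? a) w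
    count-map a []      = refl
    count-map a (b ∷ w) = cong₂ (λ d k → (if d then suc else id) k) (does-<? b a) (count-map a w)

    std-map : ∀ {n} (w : Vec ℕ n) → std (Vec.map f w) ≡ std w
    std-map w = trans (sym (Vec.map-∘ _ f w)) (Vec.map-cong (λ a → cong suc (count-map a w)) w)

    des-map : ∀ {n} (w : Vec ℕ n) → des (Vec.map f w) ≡ des w
    des-map []          = refl
    des-map (a ∷ [])    = refl
    des-map (a ∷ b ∷ w) = cong₂ (λ d n → (if d then 1 else 0) + n) (does-<? b a) (des-map (b ∷ w))

    -- Relabelling leaves the positions of an occurrence alone, and standardisation sees only the
    -- relative order of the values.
    avoids-map : ∀ {k n} (ω : Vincular k) (π : Vec ℕ n) → Avoids ω (Vec.map f π) ⇔ Avoids ω π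
    avoids-map ω π = mk⇔
      (λ avoids (is , inc , adj , eq) → avoids (is , inc , adj , trans (std-lookup is) eq))
      (λ avoids (is , inc , adj , eq) → avoids (is , inc , adj , trans (sym (std-lookup is)) eq))
      where
      std-lookup : ∀ is → std (Vec.map (lookup (Vec.map f π)) is) ≡ std (Vec.map (lookup π) is)
      std-lookup is = trans
        (cong std (trans (Vec.map-cong (λ i → Vec.lookup-map i f π) is) (Vec.map-∘ f (lookup π) is)))
        (std-map (Vec.map (lookup π) is))

    unique-map : ∀ {n} (v : Vec ℕ n) → VecUnique.Unique (Vec.map f v) ⇔ VecUnique.Unique v
    unique-map v = mk⇔ (unmap v) (VecUnique.map⁺ f-injective)
      where
      unmap : ∀ {n} (v : Vec ℕ n) → VecUnique.Unique (Vec.map f v) → VecUnique.Unique v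
      unmap []      _                     = VecAllPairs.[]
      unmap (a ∷ v) (a∉v VecAllPairs.∷ v!) =
        VecAll.map (_∘ cong f) (VecAll.map⁻ a∉v) VecAllPairs.∷ unmap v v!

    words-map : ∀ as n → words (List.map f as) n ≡ List.map (Vec.map f) (words as n)
    words-map as zero    = refl
    words-map as (suc n) = trans (cong (List.cartesianProductWith _∷_ (List.map f as)) (words-map as n))
      (product as)
      where
      product : ∀ bs → List.cartesianProductWith _∷_ (List.map f bs) (List.map (Vec.map f) (words as n)) ≡
                       List.map (Vec.map f) (List.cartesianProductWith _∷_ bs (words as n))
      product []       = refl
      product (b ∷ bs) = begin
        List.map (f b ∷_) (List.map (Vec.map f) (words as n)) ++ rest
          ≡⟨ cong₂ _++_ (trans (sym (List.map-∘ (words as n))) (List.map-∘ (words as n))) (product bs) ⟩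
        List.map (Vec.map f) (List.map (b ∷_) (words as n)) ++ _
          ≡⟨ List.map-++ (Vec.map f) (List.map (b ∷_) (words as n)) _ ⟨
        List.map (Vec.map f) (List.cartesianProductWith _∷_ (b ∷ bs) (words as n)) ∎
        where
        open ≡-Reasoning
        rest : List (Vec ℕ (suc n))
        rest = List.cartesianProductWith _∷_ (List.map f bs) (List.map (Vec.map f) (words as n))

    arrangements-map : ∀ {k} (ω : Vincular k) as n →
                       arrangements ω (List.map f as) n ≡ List.map (Vec.map f) (arrangements ω as n)
    arrangements-map ω as n = begin
      List.filter (avoids? ω) (List.filter unique? (words (List.map f as) n))
        ≡⟨ cong (List.filter (avoids? ω) ∘ List.filter unique?) (words-map as n) ⟩
      List.filter (avoids? ω) (List.filter unique? (List.map (Vec.map f) (words as n)))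
        ≡⟨ cong (List.filter (avoids? ω)) (filter-map unique? unique? unique-map (words as n)) ⟩
      List.filter (avoids? ω) (List.map (Vec.map f) (List.filter unique? (words as n)))
        ≡⟨ filter-map (avoids? ω) (avoids? ω) (avoids-map ω) (List.filter unique? (words as n)) ⟩
      List.map (Vec.map f) (arrangements ω as n) ∎
      where open ≡-Reasoning

  -- The entries of as, continued upwards so that the enumeration is strictly increasing
  -- on all of ℕ; the index b bounds the first entry from below.
  enumerate : ℕ → List ℕ → ℕ → ℕ
  enumerate b []       i       = b + i
  enumerate b (a ∷ as) zero    = a
  enumerate b (a ∷ as) (suc i) = enumerate (suc a) as i

  enumerate-applyUpTo : ∀ b as → applyUpTo (enumerate b as) (length as) ≡ as
  enumerate-applyUpTo b []       = refl
  enumerate-applyUpTo b (a ∷ as) = cong (a ∷_) (enumerate-applyUpTo (suc a) as)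

  enumerate-≥ : ∀ {b as} → All (b ≤_) as → AllPairs _<_ as → ∀ i → b ≤ enumerate b as i
  enumerate-≥ {b} []           _            i       = ℕ.m≤m+n b i
  enumerate-≥     (b≤a ∷ _)    _            zero    = b≤a
  enumerate-≥     (b≤a ∷ b≤as) (a<as ∷ as<) (suc i) =
    ℕ.≤-trans (ℕ.m≤n⇒m≤1+n b≤a) (enumerate-≥ a<as as< i)

  enumerate-mono : ∀ {b as} → AllPairs _<_ as → ∀ {i j} → i < j → enumerate b as i < enumerate b as j
  enumerate-mono {b} []           i<j                 = ℕ.+-monoʳ-< b i<j
  enumerate-mono     (a<as ∷ as<) {zero}  {suc j} _   = enumerate-≥ a<as as< j
  enumerate-mono     (a<as ∷ as<) {suc i} (s≤s i<j)   = enumerate-mono as< i<j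

open Patterns

-- Counting by descents

module WeightedCount (R : CommutativeRing 0ℓ 0ℓ) (τ : CommutativeRing.Carrier R) where

  open CommutativeRing R using (Carrier; _≈_; 0#; 1#; _*_; semiring)
  private module R = CommutativeRing R
  open Derivation R using (binomialConvolution)
  open Exp semiring using (_^_; ^-homo-*)

  ∑ˡ : {B : Set} → (B → Carrier) → List B → Carrier
  ∑ˡ h xs = List.foldr R._+_ 0# (List.map h xs)

  ∑ˡ-cong : ∀ {B : Set} {g h : B → Carrier} xs → (∀ {x} → x ∈ xs → g x ≈ h x) → ∑ˡ g xs ≈ ∑ˡ h xs
  ∑ˡ-cong []       _ = R.refl
  ∑ˡ-cong (x ∷ xs) p = R.+-cong (p (here refl)) (∑ˡ-cong xs (p ∘ there))

  ∑ˡ-map : ∀ {B C : Set} (h : C → Carrier) (f : B → C) xs → ∑ˡ h (List.map f xs) ≡ ∑ˡ (h ∘ f) xs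
  ∑ˡ-map h f xs = cong (List.foldr R._+_ 0#) (sym (List.map-∘ xs))

  ∑ˡ-++ : ∀ {B : Set} (h : B → Carrier) xs ys → ∑ˡ h (xs ++ ys) ≈ ∑ˡ h xs R.+ ∑ˡ h ys
  ∑ˡ-++ h []       ys = R.sym (R.+-identityˡ _)
  ∑ˡ-++ h (x ∷ xs) ys = R.trans (R.+-congˡ (∑ˡ-++ h xs ys)) (R.sym (R.+-assoc _ _ _))

  ∑ˡ-concatMap : ∀ {B C : Set} (h : C → Carrier) (f : B → List C) xs →
                 ∑ˡ h (List.concatMap f xs) ≈ ∑ˡ (∑ˡ h ∘ f) xs
  ∑ˡ-concatMap h f []       = R.refl
  ∑ˡ-concatMap h f (x ∷ xs) = R.trans (∑ˡ-++ h (f x) (List.concatMap f xs)) (R.+-congˡ (∑ˡ-concatMap h f xs))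

  ∑ˡ-*ˡ : ∀ {B : Set} c (h : B → Carrier) xs → ∑ˡ (λ x → c * h x) xs ≈ c * ∑ˡ h xs
  ∑ˡ-*ˡ c h []       = R.sym (R.zeroʳ c)
  ∑ˡ-*ˡ c h (x ∷ xs) = R.trans (R.+-congˡ (∑ˡ-*ˡ c h xs)) (R.sym (R.distribˡ c _ _))

  ∑ˡ-product : ∀ {B C : Set} (g : B → Carrier) (h : C → Carrier) xs ys →
    ∑ˡ (λ (x , y) → g x * h y) (List.cartesianProduct xs ys) ≈ ∑ˡ g xs * ∑ˡ h ys
  ∑ˡ-product g h []       ys = R.sym (R.zeroˡ _)
  ∑ˡ-product g h (x ∷ xs) ys = begin
    ∑ˡ gh (List.map (x ,_) ys ++ List.cartesianProduct xs ys)
      ≈⟨ ∑ˡ-++ gh (List.map (x ,_) ys) _ ⟩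
    ∑ˡ gh (List.map (x ,_) ys) R.+ ∑ˡ gh (List.cartesianProduct xs ys)
      ≈⟨ R.+-cong (R.trans (R.reflexive (∑ˡ-map gh (x ,_) ys)) (∑ˡ-*ˡ (g x) h ys)) (∑ˡ-product g h xs ys) ⟩
    g x * ∑ˡ h ys R.+ ∑ˡ g xs * ∑ˡ h ys
      ≈⟨ R.distribʳ _ _ _ ⟨
    ∑ˡ g (x ∷ xs) * ∑ˡ h ys ∎
    where
    open SetoidReasoning R.setoid
    gh : _ → Carrier
    gh (x , y) = g x * h y

  ∑ˡ-↭ : ∀ {B : Set} (h : B → Carrier) {xs ys} → xs ↭ ys → ∑ˡ h xs ≈ ∑ˡ h ys
  ∑ˡ-↭ h ↭.refl          = R.refl
  ∑ˡ-↭ h (↭.prep x p)    = R.+-congˡ (∑ˡ-↭ h p)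
  ∑ˡ-↭ h (↭.swap x y p)  = R.trans (R.sym (R.+-assoc _ _ _))
    (R.trans (R.+-cong (R.+-comm _ _) (∑ˡ-↭ h p)) (R.+-assoc _ _ _))
  ∑ˡ-↭ h (↭.trans p q)   = R.trans (∑ˡ-↭ h p) (∑ˡ-↭ h q)

  -- Sending the first letter left or right is exactly the recursion of `binomialConvolution`, so
  -- the binomial coefficients never appear explicitly.
  ∑-splits : ∀ (a b : ℕ → Carrier) as →
    ∑ˡ (λ (l , r) → a (length l) * b (length r)) (splits as) ≈ binomialConvolution a b (length as)
  ∑-splits a b []       = R.+-identityʳ _
  ∑-splits a b (x ∷ as) = R.trans (∑ˡ-++ ab (List.map (map₁ (x ∷_)) (splits as)) _)
    (R.+-cong
      (R.trans (R.reflexive (∑ˡ-map ab (map₁ (x ∷_)) (splits as))) (∑-splits (a ∘ suc) b as))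
      (R.trans (R.reflexive (∑ˡ-map ab (map₂ (x ∷_)) (splits as))) (∑-splits a (b ∘ suc) as)))
    where
    ab : List ℕ × List ℕ → Carrier
    ab (l , r) = a (length l) * b (length r)

  weight : List ℕ → Carrier
  weight w = τ ^ desˡ w

  count : ∀ {k} → Vincular k → List ℕ → ℕ → Carrier
  count ω as n = ∑ˡ (λ π → τ ^ des π) (arrangements ω as n)

  opaque
    total : ∀ {k} → Vincular k → ℕ → Carrier
    total ω n = ∑ˡ (λ π → τ ^ des π) (𝔖-avoiding ω n)

    total-def : ∀ {k} (ω : Vincular k) n → total ω n ≡ ∑ˡ (λ π → τ ^ des π) (𝔖-avoiding ω n)
    total-def ω n = refl

  ∑-avoiders : ∀ {k} (ω : Vincular k) as → ∑ˡ weight (avoiders ω as) ≡ count ω as (length as)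
  ∑-avoiders ω as = begin
    ∑ˡ weight (avoiders ω as)
      ≡⟨ cong (∑ˡ weight) (avoiders≡arrangements ω as) ⟩
    ∑ˡ weight (List.map toList (arrangements ω as (length as)))
      ≡⟨ ∑ˡ-map weight toList (arrangements ω as (length as)) ⟩
    ∑ˡ (weight ∘ toList) (arrangements ω as (length as))
      ≡⟨ cong (List.foldr R._+_ 0#)
           (List.map-cong (λ π → cong (τ ^_) (desˡ-toList π)) (arrangements ω as (length as))) ⟩
    count ω as (length as) ∎
    where open ≡-Reasoning

  count-map : ∀ {k} (ω : Vincular k) {f : ℕ → ℕ} → (∀ {i j} → i < j → f i < f j) → ∀ as n →
              count ω (List.map f as) n ≡ count ω as n
  count-map ω {f} f-mono as n = begin
    ∑ˡ τ^des (arrangements ω (List.map f as) n)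
      ≡⟨ cong (∑ˡ τ^des) (arrangements-map ω as n) ⟩
    ∑ˡ τ^des (List.map (Vec.map f) (arrangements ω as n))
      ≡⟨ ∑ˡ-map τ^des (Vec.map f) (arrangements ω as n) ⟩
    ∑ˡ (τ^des ∘ Vec.map f) (arrangements ω as n)
      ≡⟨ cong (List.foldr R._+_ 0#) (List.map-cong (λ π → cong (τ ^_) (des-map π)) (arrangements ω as n)) ⟩
    count ω as n ∎
    where
    open ≡-Reasoning
    open Relabelling f f-mono
    τ^des : ∀ {n} → Vec ℕ n → Carrier
    τ^des π = τ ^ des π

  count-applyUpTo : ∀ {k} (ω : Vincular k) {f : ℕ → ℕ} → (∀ {i j} → i < j → f i < f j) → ∀ n →
                    count ω (applyUpTo f n) n ≡ count ω (upTo n) n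
  count-applyUpTo ω {f} f-mono n =
    trans (cong (λ as → count ω as n) (sym (List.map-upTo f n))) (count-map ω f-mono (upTo n) n)

  -- A sorted alphabet and 1, ..., n are both increasing images of 0, ..., n - 1, so the count
  -- depends on the number of letters only.
  count-sorted : ∀ {k} (ω : Vincular k) {as} → AllPairs _<_ as → count ω as (length as) ≡ total ω (length as)
  count-sorted ω {as} as< = begin
    count ω as (length as)
      ≡⟨ cong (λ bs → count ω bs (length as)) (enumerate-applyUpTo 0 as) ⟨
    count ω (applyUpTo (enumerate 0 as) (length as)) (length as)
      ≡⟨ count-applyUpTo ω (enumerate-mono as<) (length as) ⟩
    count ω (upTo (length as)) (length as)
      ≡⟨ count-applyUpTo ω s≤s (length as) ⟨
    count ω (applyUpTo suc (length as)) (length as)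
      ≡⟨ total-def ω (length as) ⟨
    total ω (length as) ∎
    where open ≡-Reasoning

  ∑-avoiders-applyUpTo : ∀ {k} (ω : Vincular k) n → ∑ˡ weight (avoiders ω (applyUpTo suc n)) ≡ total ω n
  ∑-avoiders-applyUpTo ω n = trans (∑-avoiders ω (applyUpTo suc n))
    (trans (cong (count ω (applyUpTo suc n)) (List.length-applyUpTo suc n)) (sym (total-def ω n)))

  ∑-avoiders-sorted : ∀ {k} (ω : Vincular k) {as} → AllPairs _<_ as →
                      ∑ˡ weight (avoiders ω as) ≈ total ω (length as)
  ∑-avoiders-sorted ω as< = R.reflexive (trans (∑-avoiders ω _) (count-sorted ω as<))

  avoids-[] : ∀ {k} (ω : Vincular (suc k)) → Avoids ω []
  avoids-[] ω (() ∷ _ , _)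

  𝔖-avoiding-0 : ∀ {k} (ω : Vincular (suc k)) → 𝔖-avoiding ω 0 ≡ [] ∷ []
  𝔖-avoiding-0 ω = trans
    (cong (List.filter (avoids? ω)) (List.filter-accept unique? {xs = []} VecAllPairs.[]))
    (List.filter-accept (avoids? ω) {xs = []} (avoids-[] ω))

  total-0 : ∀ {k} (ω : Vincular (suc k)) → total ω 0 ≈ 1#
  total-0 ω = R.trans
    (R.reflexive (trans (total-def ω 0) (cong (∑ˡ (λ π → τ ^ des π)) (𝔖-avoiding-0 ω))))
    (R.+-identityʳ 1#)

  module _ {m} (σ : Vec ℕ (suc m)) where

    open Decomposition σ

    -- t^{des R + 1} for the part R after the largest letter, but 1 when R is empty.
    tail : ℕ → Carrier
    tail zero    = 1#
    tail (suc n) = τ * total p (suc n)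

    ∑-tails : ∀ {r M} → All (_< M) r → AllPairs _<_ r →
              ∑ˡ (λ R → weight (M ∷ R)) (avoiders p r) ≈ tail (length r)
    ∑-tails {[]} {M} _ _ = R.trans
      (R.reflexive (cong (∑ˡ (λ R → weight (M ∷ R)))
        (trans (avoiders≡arrangements p []) (cong (List.map toList) (𝔖-avoiding-0 p)))))
      (R.+-identityʳ 1#)
    ∑-tails {r@(_ ∷ _)} {M} r<M r< = begin
      ∑ˡ (λ R → weight (M ∷ R)) (avoiders p r) ≈⟨ ∑ˡ-cong (avoiders p r) nonempty ⟩
      ∑ˡ (λ R → τ * weight R) (avoiders p r)   ≈⟨ ∑ˡ-*ˡ τ weight (avoiders p r) ⟩
      τ * ∑ˡ weight (avoiders p r)             ≈⟨ R.*-congˡ (∑-avoiders-sorted p r<) ⟩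
      τ * total p (length r)                   ∎
      where
      open SetoidReasoning R.setoid
      nonempty : ∀ {R} → R ∈ avoiders p r → weight (M ∷ R) ≈ τ * weight R
      nonempty {[]}    R∈ = contradiction (↭-sym (proj₁ (∈p⁻ {r} R∈))) ↭.¬x∷xs↭[]
      nonempty {b ∷ R} R∈ = R.reflexive (cong (τ ^_) (desˡ-∷-max R
        (All.lookup r<M (↭.∈-resp-↭ (proj₁ (∈p⁻ {r} R∈)) (here refl)))))

    -- The equation (Aᵖ)′ = A^σ · G, read off coefficient by coefficient.
    total-suc : ∀ n → total p (suc n) ≈ binomialConvolution (total c) tail n
    total-suc n = begin
      total p (suc n)
        ≡⟨ ∑-avoiders-applyUpTo p (suc n) ⟨
      ∑ˡ weight (avoiders p ls)
        ≈⟨ ∑ˡ-↭ weight (avoiders-join as< as<M ls↭) ⟩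
      ∑ˡ weight (List.map (join M) (List.concatMap pairs (splits as)))
        ≡⟨ ∑ˡ-map weight (join M) (List.concatMap pairs (splits as)) ⟩
      ∑ˡ (weight ∘ join M) (List.concatMap pairs (splits as))
        ≈⟨ ∑ˡ-concatMap (weight ∘ join M) pairs (splits as) ⟩
      ∑ˡ (∑ˡ (weight ∘ join M) ∘ pairs) (splits as)
        ≈⟨ ∑ˡ-cong (splits as) (λ {s} → block s) ⟩
      ∑ˡ (λ (l , r) → total c (length l) * tail (length r)) (splits as)
        ≈⟨ ∑-splits (total c) tail as ⟩
      binomialConvolution (total c) tail (length as)
        ≡⟨ cong (binomialConvolution (total c) tail) (List.length-applyUpTo suc n) ⟩
      binomialConvolution (total c) tail n ∎
      where
      open SetoidReasoning R.setoid

      M : ℕ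
      M = suc n

      as ls : List ℕ
      as = applyUpTo suc n
      ls = applyUpTo suc (suc n)

      as< : AllPairs _<_ as
      as< = AllPairs.applyUpTo⁺₁ suc n (λ i<j _ → s≤s i<j)

      as<M : All (_< M) as
      as<M = All.applyUpTo⁺₁ suc n s≤s

      ls↭ : ls ↭ M ∷ as
      ls↭ = ↭-trans (↭-reflexive (sym (List.applyUpTo-∷ʳ suc n))) (↭-sym (↭.∷↭∷ʳ M as))

      block : ∀ s → s ∈ splits as →
              ∑ˡ (weight ∘ join M) (pairs s) ≈ total c (length (proj₁ s)) * tail (length (proj₂ s))
      block (l , r) s∈ = begin
        ∑ˡ (weight ∘ join M) (pairs (l , r))
          ≈⟨ ∑ˡ-cong (pairs (l , r)) (λ {LR} → split LR) ⟩
        ∑ˡ (λ (L , R) → weight L * weight (M ∷ R)) (pairs (l , r))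
          ≈⟨ ∑ˡ-product weight (λ R → weight (M ∷ R)) (avoiders c l) (avoiders p r) ⟩
        ∑ˡ weight (avoiders c l) * ∑ˡ (λ R → weight (M ∷ R)) (avoiders p r)
          ≈⟨ R.*-cong (∑-avoiders-sorted c (proj₁ (splits-sorted as< s∈)))
               (∑-tails (All.tabulate (All.lookup as<M ∘ splits-⊆ʳ s∈)) (proj₂ (splits-sorted as< s∈))) ⟩
        total c (length l) * tail (length r) ∎
        where
        -- Descents add over the cut, so the weight is a product and the sum over pairs factors.
        split : ∀ LR → LR ∈ pairs (l , r) → weight (join M LR) ≈ weight (proj₁ LR) * weight (M ∷ proj₂ LR)
        split (L , R) LR∈ = R.trans
          (R.reflexive (cong (τ ^_) (desˡ-split R L<M)))
          (^-homo-* τ (desˡ L) (desˡ (M ∷ R)))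
          where
          L<M : All (_< M) L
          L<M = All.tabulate (All.lookup as<M ∘ splits-⊆ˡ s∈ ∘
            ↭.∈-resp-↭ (proj₁ (∈c⁻ {l} (proj₁ (∈-cartesianProduct⁻ (avoiders c l) (avoiders p r) LR∈)))))

-- The identity over the ring of Laurent series

open K⟦x⟧ using (_≈_; _+_; _-_; _*_; 1#; const; exp; ∫)

module K-count = WeightedCount K-commutativeRing t

Aₙ≡total : ∀ {k} (ω : Vincular k) n → Aₙ ω n ≡ K-count.total ω n
Aₙ≡total ω n = trans (sum-raw (𝔖-avoiding ω n)) (sym (K-count.total-def ω n))
  where
  sum-raw : ∀ (xs : List (Vec ℕ n)) →
    List.foldr K._+_ K.0# (List.map (λ π → t K.^ des π) xs) ≡ K-count.∑ˡ (λ π → t K.^ des π) xs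
  sum-raw xs = refl

-- Writing `k` as `suc (suc m)` exhibits `σ` as a non-empty word, as the decomposition requires. The
-- existential hides how `b` is built from the avoiders of `p`, so that it acts as a variable
-- afterwards.
recurrence : ∀ k → 2 ≤ k → (σ : Vec ℕ (k ∸ 1)) → ∃ λ b →
  b 0 K.≈ K.1# ×
  (∀ n → b (suc n) K.≈ t K.* K-count.total (consecutive σ ▹ k) (suc n)) ×
  K-count.total (consecutive σ ▹ k) 0 K.≈ K.1# ×
  (∀ n → K-count.total (consecutive σ ▹ k) (suc n) K.≈
         Derivation.binomialConvolution K-commutativeRing (K-count.total (consecutive σ)) b n)
recurrence (suc (suc m)) (s≤s (s≤s _)) σ =
  K-count.tail σ ,
  KR.refl {K.1#} ,
  (λ n → KR.refl {t K.* K-count.total (consecutive σ ▹ suc (suc m)) (suc n)}) ,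
  K-count.total-0 (consecutive σ ▹ suc (suc m)) ,
  K-count.total-suc σ

theorem1p2 : ∀ (k : ℕ) → 2 ≤ k → (σ : Vec ℕ (k ∸ 1)) → σ ∈ 𝔖 (k ∸ 1) →
    A (consecutive σ ▹ k)
    ≈ const t⁻¹ * (exp (const t * ∫ (A (consecutive σ))) - 1#) + 1#
theorem1p2 k 2≤k σ σ∈ = instantiate refl refl refl refl refl refl refl refl
  where
  -- The formula is applied while all intermediate series are still variables; only `transport`
  -- substitutes their definitions, once the identity is already proved.
  instantiate : ∀ {A′ P I φ E F G H} → A′ ≡ A (consecutive σ) → P ≡ A (consecutive σ ▹ k) →
    I ≡ ∫ A′ → φ ≡ const t * I → E ≡ exp φ → F ≡ E - 1# → G ≡ const t⁻¹ * F → H ≡ G + 1# →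
    A (consecutive σ ▹ k) ≈ const t⁻¹ * (exp (const t * ∫ (A (consecutive σ))) - 1#) + 1#
  instantiate {A′} {P} {I} {φ} {E} {F} {G} {H} A′≡ P≡ I≡ φ≡ E≡ F≡ G≡ H≡ =
    let b , b₀ , bₛ , p₀ , pₛ = recurrence k 2≤k σ in
    transport A′≡ P≡ I≡ φ≡ E≡ F≡ G≡ H≡
      (exponentialFormula-K (K-count.total (consecutive σ)) b (K-count.total (consecutive σ ▹ k)) b₀ bₛ p₀ pₛ
        A′ P I φ E F G H (values (consecutive σ) A′≡) (values (consecutive σ ▹ k) P≡)
        I≡ φ≡ E≡ F≡ G≡ H≡)
    where
    values : ∀ {k} (ω : Vincular k) {X} → X ≡ A ω → ∀ n → X n ≡ K⟦x⟧.1/ n ! K.* K-count.total ω n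
    values ω X≡ n = trans (cong (λ f → f n) X≡) (cong (K⟦x⟧.1/ n ! K.*_) (Aₙ≡total ω n))

    transport : A′ ≡ A (consecutive σ) → P ≡ A (consecutive σ ▹ k) →
      I ≡ ∫ A′ → φ ≡ const t * I → E ≡ exp φ → F ≡ E - 1# → G ≡ const t⁻¹ * F → H ≡ G + 1# → P ≈ H →
      A (consecutive σ ▹ k) ≈ const t⁻¹ * (exp (const t * ∫ (A (consecutive σ))) - 1#) + 1#
    transport refl refl refl refl refl refl refl refl P≈H = P≈H
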